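{- For every fixed integer $d \ge 2$, $$\lim_{t \rightarrow \infty} \frac{\operatorname{scc}(K_t(d))}{\frac{d}{2}\, t\log_2 t}=1,$$ where $K_t(d)$ denotes the complete $t$-partite graph with each part of size $d$ and $\operatorname{scc}$ denotes the sigma clique cover number.
   Context: A clique of a graph $G$ is a complete subgraph of $G$; its size is its number of vertices. A clique covering of a graph $G$ is a set $\mathcal{C}$ of cliques of $G$ such that every edge of $G$ is contained in at least one of the cliques in $\mathcal{C}$. The weight of a clique covering $\mathcal{C}$ is $\sum_{C\in\mathcal{C}}|C|$, the sum of the sizes of its cliques. The sigma clique cover number $\operatorname{scc}(G)$ is the smallest possible weight of a clique covering of $G$. $K_t(d)$ is the graph on $td$ vertices partitioned into $t$ parts of size $d$, in which two vertices are adjacent if and only if they lie in different parts. -}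

module Defs where

open import Data.Bool.Properties as Bool using ()
open import Data.Empty using (⊥; ⊥-elim)
open import Data.Fin using (Fin; quotient)
open import Data.Fin.Properties as Fin using ()
open import Data.Fin.Subset using (Subset; _∈_; ∣_∣; ⁅_⁆; _∪_; inside; outside)
open import Data.Fin.Subset.Properties using (_∈?_; x∈⁅x⁆; x∈⁅y⁆⇒x≡y; x∈p∪q⁺; x∈p∪q⁻)
open import Data.Integer as ℤ using (ℤ; +_; -[1+_])
import Data.Integer.Properties as ℤ
open import Data.List using (List; []; _∷_; _++_; map; filter)
import Data.List.Membership.DecPropositional as DecMembership
open import Data.List.Membership.Propositional as List using (lose)
open import Data.List.Membership.Propositional.Properties using (∈-++⁺ˡ; ∈-++⁺ʳ; ∈-map⁺; ∈-map⁻; ∈-filter⁺; ∈-filter⁻)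
open import Data.List.Membership.Propositional.Properties.WithK using (unique∧set⇒bag)
open import Data.List.Relation.Binary.BagAndSetEquality using (∼bag⇒↭)
open import Data.List.Relation.Binary.Disjoint.Propositional using (Disjoint)
open import Data.List.Relation.Binary.Permutation.Propositional using (_↭_)
open import Data.List.Relation.Binary.Permutation.Propositional.Properties as ↭ using ()
open import Data.List.Relation.Unary.All as All using (All)
open import Data.List.Relation.Unary.Any as Any using (Any; here)
import Data.List.Relation.Unary.Unique.DecPropositional as DecUnique
open import Data.List.Relation.Unary.Unique.Propositional using (Unique; []; _∷_)
open import Data.List.Relation.Unary.Unique.Propositional.Properties as Unique using ()
open import Data.Nat as ℕ using (ℕ; zero; suc; _^_; z≤n; s≤s)
open import Data.Nat.ListAction using (sum)
open import Data.Nat.ListAction.Properties using (sum-↭)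
import Data.Nat.Properties as ℕ
open import Data.Nat.Solver using (module +-*-Solver)
open import Data.Product using (∃; _×_; _,_; proj₁; proj₂)
open import Data.Rational.Unnormalised using (ℚᵘ; mkℚᵘ; 0ℚᵘ; 1ℚᵘ; _/_; _<_; *<*; _≃_; _+_; _*_; _-_; -_; 1/_; NonNegative; Positive; positive; nonNegative)
open import Data.Rational.Unnormalised.Properties as ℚ using (<-dense; <-trans; <-≤-trans; ≤-<-trans; <⇒≤; ≃-sym; ≃-trans; <-respˡ-≃; <-respʳ-≃; pos⇒nonZero)
open import Data.Sum using (_⊎_; inj₁; inj₂)
open import Data.Vec using ([]; _∷_)
open import Data.Vec.Properties as Vec using ()
open import Function using (_∘_; mk⇔)
open import Level using (0ℓ)
open import Relation.Binary using (Rel; Symmetric; Decidable)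
open import Relation.Binary.PropositionalEquality using (_≡_; _≢_; refl; sym; trans; cong; subst; subst₂)
open import Relation.Nullary using (¬_; Dec; yes; no; ¬?)
open import Relation.Nullary.Decidable using (map′; _×-dec_; _→-dec_)

record Graph (n : ℕ) : Set₁ where
  field
    Adj    : Rel (Fin n) 0ℓ
    adj?   : Decidable Adj
    symm   : Symmetric Adj
    irrefl : ∀ {i} → ¬ Adj i i

-- Complete t-partite graph with parts of size d: under Fin (t * d) ≅ Fin t × Fin d,
-- the part of a vertex is its first coordinate.
K : (t d : ℕ) → Graph (t ℕ.* d)
K t d = record
  { Adj    = λ i j → quotient {t} d i ≢ quotient {t} d j
  ; adj?   = λ i j → ¬? (quotient {t} d i Fin.≟ quotient {t} d j)
  ; symm   = λ i≢j → i≢j ∘ sym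
  ; irrefl = λ i≢i → i≢i refl
  }

-- A clique is identified with its vertex set.
IsClique : ∀ {n} → Graph n → Subset n → Set
IsClique G S = ∀ i j → i ∈ S → j ∈ S → i ≢ j → Graph.Adj G i j

Covers : ∀ {n} → Graph n → List (Subset n) → Set
Covers G Ss = ∀ i j → Graph.Adj G i j → Any (λ S → i ∈ S × j ∈ S) Ss

-- A finite set of cliques is a duplicate-free list; the order of the list is irrelevant to covers and weight.
record CliqueCovering {n} (G : Graph n) : Set where
  field
    cliques    : List (Subset n)
    unique     : Unique cliques
    areCliques : All (IsClique G) cliques
    covers     : Covers G cliques

  weight : ℕ
  weight = sum (map ∣_∣ cliques)

open CliqueCovering using (weight)

IsLeast : (ℕ → Set) → ℕ → Set
IsLeast P k = P k × (∀ m → P m → k ℕ.≤ m)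

IsWeight : ∀ {n} → Graph n → ℕ → Set
IsWeight G w = ∃ λ (C : CliqueCovering G) → weight C ≡ w

least : (P : ℕ → Set) → (∀ m → Dec (P m)) → ∀ n → P n → ∃ (IsLeast P)
least P P? n pn with P? 0
... | yes p0 = 0 , p0 , λ _ _ → z≤n
least P P? zero    pn | no ¬p0 = ⊥-elim (¬p0 pn)
least P P? (suc n) pn | no ¬p0 with least (P ∘ suc) (P? ∘ suc) n pn
... | k , pk , k≤ = suc k , pk , λ { zero p0 → ⊥-elim (¬p0 p0) ; (suc m) pm → s≤s (k≤ m pm) }

subsets : ∀ n → List (Subset n)
subsets zero    = [] ∷ []
subsets (suc n) = map (outside ∷_) (subsets n) ++ map (inside ∷_) (subsets n)

subsets-complete : ∀ {n} (S : Subset n) → S List.∈ subsets n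
subsets-complete []            = here refl
subsets-complete (outside ∷ S) = ∈-++⁺ˡ (∈-map⁺ _ (subsets-complete S))
subsets-complete (inside ∷ S)  = ∈-++⁺ʳ _ (∈-map⁺ _ (subsets-complete S))

subsets-unique : ∀ n → Unique (subsets n)
subsets-unique zero    = All.[] ∷ []
subsets-unique (suc n) = Unique.++⁺ (Unique.map⁺ Vec.∷-injectiveʳ u) (Unique.map⁺ Vec.∷-injectiveʳ u) disjoint
  where
  u = subsets-unique n
  disjoint : Disjoint (map (outside ∷_) (subsets n)) (map (inside ∷_) (subsets n))
  disjoint (v∈₁ , v∈₂) with ∈-map⁻ (outside ∷_) v∈₁ | ∈-map⁻ (inside ∷_) v∈₂
  ... | _ , _ , refl | _ , _ , ()

sublists : ∀ {A : Set} → List A → List (List A)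
sublists []       = [] ∷ []
sublists (x ∷ xs) = sublists xs ++ map (x ∷_) (sublists xs)

filter∈sublists : ∀ {A : Set} {P : A → Set} (P? : ∀ x → Dec (P x)) xs → filter P? xs List.∈ sublists xs
filter∈sublists P? []       = here refl
filter∈sublists P? (x ∷ xs) with P? x
... | yes _ = ∈-++⁺ʳ (sublists xs) (∈-map⁺ _ (filter∈sublists P? xs))
... | no  _ = ∈-++⁺ˡ (filter∈sublists P? xs)

module _ {n} (G : Graph n) where
  open Graph G

  isClique? : ∀ S → Dec (IsClique G S)
  isClique? S = Fin.all? λ i → Fin.all? λ j →
    (i ∈? S) →-dec ((j ∈? S) →-dec (¬? (i Fin.≟ j) →-dec adj? i j))

  covers? : ∀ Ss → Dec (Covers G Ss)
  covers? Ss = Fin.all? λ i → Fin.all? λ j →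
    adj? i j →-dec Any.any? (λ S → (i ∈? S) ×-dec (j ∈? S)) Ss

  allCliques : CliqueCovering G
  allCliques = record
    { cliques    = filter isClique? (subsets n)
    ; unique     = Unique.filter⁺ isClique? (subsets-unique n)
    ; areCliques = All.tabulate (proj₂ ∘ ∈-filter⁻ isClique? {xs = subsets n})
    ; covers     = λ i j ij → lose
        (∈-filter⁺ isClique? (subsets-complete (⁅ i ⁆ ∪ ⁅ j ⁆)) (pair i j ij))
        (x∈p∪q⁺ (inj₁ (x∈⁅x⁆ i)) , x∈p∪q⁺ (inj₂ (x∈⁅x⁆ j)))
    }
    where
    pair : ∀ i j → Adj i j → IsClique G (⁅ i ⁆ ∪ ⁅ j ⁆)
    pair i j ij k l k∈ l∈ k≢l
      with x∈p∪q⁻ ⁅ i ⁆ ⁅ j ⁆ k∈ | x∈p∪q⁻ ⁅ i ⁆ ⁅ j ⁆ l∈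
    ... | inj₁ p | inj₁ q rewrite x∈⁅y⁆⇒x≡y i p | x∈⁅y⁆⇒x≡y i q = ⊥-elim (k≢l refl)
    ... | inj₁ p | inj₂ q rewrite x∈⁅y⁆⇒x≡y i p | x∈⁅y⁆⇒x≡y j q = ij
    ... | inj₂ p | inj₁ q rewrite x∈⁅y⁆⇒x≡y j p | x∈⁅y⁆⇒x≡y i q = symm ij
    ... | inj₂ p | inj₂ q rewrite x∈⁅y⁆⇒x≡y j p | x∈⁅y⁆⇒x≡y j q = ⊥-elim (k≢l refl)

  isWeight? : ∀ w → Dec (IsWeight G w)
  isWeight? w = map′ to from (Any.any? good? (sublists (subsets n)))
    where
    _≟_ : (S T : Subset n) → Dec (S ≡ T)
    _≟_ = Vec.≡-dec Bool._≟_
    open DecMembership _≟_ using () renaming (_∈?_ to _∈ₗ?_)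

    Good : List (Subset n) → Set
    Good Ss = Unique Ss × All (IsClique G) Ss × Covers G Ss × sum (map ∣_∣ Ss) ≡ w

    good? : ∀ Ss → Dec (Good Ss)
    good? Ss = DecUnique.unique? _≟_ Ss ×-dec All.all? isClique? Ss ×-dec covers? Ss ×-dec (_ ℕ.≟ w)

    to : Any Good (sublists (subsets n)) → IsWeight G w
    to any with Any.satisfied any
    ... | Ss , u , a , c , eq = record { cliques = Ss ; unique = u ; areCliques = a ; covers = c } , eq

    from : IsWeight G w → Any Good (sublists (subsets n))
    from (C , eq) = lose (filter∈sublists in? (subsets n))
      ( u
      , ↭.All-resp-↭ perm areCliques
      , (λ i j ij → ↭.Any-resp-↭ perm (covers i j ij))
      , trans (sym (sum-↭ (↭.map⁺ ∣_∣ perm))) eq )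
      where
      open CliqueCovering C
      in? : ∀ S → Dec (S List.∈ cliques)
      in? S = S ∈ₗ? cliques
      u : Unique (filter in? (subsets n))
      u = Unique.filter⁺ in? (subsets-unique n)
      perm : cliques ↭ filter in? (subsets n)
      perm = ∼bag⇒↭ (unique∧set⇒bag unique u (mk⇔ (λ S∈ → ∈-filter⁺ in? (subsets-complete _) S∈) (λ S∈ → proj₂ (∈-filter⁻ in? {xs = subsets n} S∈))))

  scc-exists : ∃ (IsLeast (IsWeight G))
  scc-exists = least (IsWeight G) isWeight? (weight allCliques) (allCliques , refl)

  scc : ℕ
  scc = proj₁ scc-exists

-- Two-sided (located) Dedekind reals over the unnormalised rationals:
-- Lower p is p < x, Upper q is x < q.
record ℝ : Set₁ where
  field
    Lower Upper : ℚᵘ → Set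
    lower-inhabited : ∃ Lower
    upper-inhabited : ∃ Upper
    lower-down : ∀ {p q} → p < q → Lower q → Lower p
    lower-open : ∀ {p} → Lower p → ∃ λ q → p < q × Lower q
    upper-up   : ∀ {p q} → p < q → Upper p → Upper q
    upper-open : ∀ {q} → Upper q → ∃ λ p → p < q × Upper p
    disjoint   : ∀ {p} → Lower p → Upper p → ⊥
    located    : ∀ {p q} → p < q → Lower p ⊎ Upper q

open ℝ

Pos : ℝ → Set
Pos x = Lower x 0ℚᵘ

lower<upper : ∀ x {p q} → Lower x p → Upper x q → p < q
lower<upper x {p} {q} p<x x<q with p ℚ.<? q
... | yes p<q = p<q
... | no  p≮q with upper-open x x<q
...   | q′ , q′<q , x<q′ = ⊥-elim (disjoint x p<x (upper-up x (<-≤-trans q′<q (ℚ.≮⇒≥ p≮q)) x<q′))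

private
  1/⁺ : ∀ s → 0ℚᵘ < s → ℚᵘ
  1/⁺ s 0<s = (1/ s) {{pos⇒nonZero s {{positive 0<s}}}}

  s*1/s : ∀ s (0<s : 0ℚᵘ < s) → s * 1/⁺ s 0<s ≃ 1ℚᵘ
  s*1/s s 0<s = ℚ.*-inverseʳ s {{pos⇒nonZero s {{positive 0<s}}}}

  1/s>0 : ∀ s (0<s : 0ℚᵘ < s) → Positive (1/⁺ s 0<s)
  1/s>0 s 0<s = ℚ.1/pos⇒pos s {{positive 0<s}}

  m/s*s : ∀ m s (0<s : 0ℚᵘ < s) → m * 1/⁺ s 0<s * s ≃ m
  m/s*s m s 0<s = ≃-trans (ℚ.*-assoc m (1/⁺ s 0<s) s)
    (≃-trans (ℚ.*-congˡ {m} (≃-trans (ℚ.*-comm (1/⁺ s 0<s) s) (s*1/s s 0<s))) (ℚ.*-identityʳ m))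

  s*m/s : ∀ m s (0<s : 0ℚᵘ < s) → s * (m * 1/⁺ s 0<s) ≃ m
  s*m/s m s 0<s = ≃-trans (ℚ.*-comm s (m * 1/⁺ s 0<s)) (m/s*s m s 0<s)

  0<1 : 0ℚᵘ < 1ℚᵘ
  0<1 = *<* (ℤ.+<+ (s≤s z≤n))

  p-1<p : ∀ p → p - 1ℚᵘ < p
  p-1<p p = <-respʳ-≃ (ℚ.+-identityʳ p) (ℚ.+-monoʳ-< p {x = - 1ℚᵘ} {y = 0ℚᵘ} (*<* ℤ.-<+))

  p<p+1 : ∀ p → p < p + 1ℚᵘ
  p<p+1 p = <-respˡ-≃ (ℚ.+-identityʳ p) (ℚ.+-monoʳ-< p {x = 0ℚᵘ} {y = 1ℚᵘ} 0<1)

infixr 7 _·_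

-- The product of a non-negative rational with a real.
_·_ : (c : ℚᵘ) .{{_ : NonNegative c}} → ℝ → ℝ
c · x = record
  { Lower = λ r → ∃ λ p → Lower x p × r < c * p
  ; Upper = λ r → ∃ λ q → Upper x q × c * q < r
  ; lower-inhabited = let p , p<x = lower-inhabited x in _ , p , p<x , p-1<p (c * p)
  ; upper-inhabited = let q , x<q = upper-inhabited x in _ , q , x<q , p<p+1 (c * q)
  ; lower-down = λ { r<r′ (p , p<x , r′<cp) → p , p<x , <-trans r<r′ r′<cp }
  ; lower-open = λ { (p , p<x , r<cp) → let m , r<m , m<cp = <-dense r<cp in m , r<m , p , p<x , m<cp }
  ; upper-up = λ { r<r′ (q , x<q , cq<r) → q , x<q , <-trans cq<r r<r′ }
  ; upper-open = λ { (q , x<q , cq<r) → let m , cq<m , m<r = <-dense cq<r in m , m<r , q , x<q , cq<m }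
  ; disjoint = λ { (p , p<x , r<cp) (q , x<q , cq<r) → ℚ.<-irrefl ℚ.≃-refl
      (<-trans r<cp (≤-<-trans (ℚ.*-monoʳ-≤-nonNeg c (<⇒≤ (lower<upper x p<x x<q))) cq<r)) }
  ; located = loc
  }
  where
  loc : ∀ {r r′} → r < r′ → (∃ λ p → Lower x p × r < c * p) ⊎ (∃ λ q → Upper x q × c * q < r′)
  loc {r} {r′} r<r′ with 0ℚᵘ ℚ.<? c
  ... | yes 0<c = case (located x m₁<m₂)
    where
    a<b : r * 1/⁺ c 0<c < r′ * 1/⁺ c 0<c
    a<b = ℚ.*-monoˡ-<-pos (1/⁺ c 0<c) {{1/s>0 c 0<c}} r<r′
    d₁ = <-dense a<b
    m₁ = proj₁ d₁
    d₂ = <-dense (proj₂ (proj₂ d₁))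
    m₂ = proj₁ d₂
    m₁<m₂ : m₁ < m₂
    m₁<m₂ = proj₁ (proj₂ d₂)
    case : Lower x m₁ ⊎ Upper x m₂ → _
    case (inj₁ m₁<x) = inj₁ (m₁ , m₁<x , <-respˡ-≃ (s*m/s r c 0<c) (ℚ.*-monoʳ-<-pos c {{positive 0<c}} (proj₁ (proj₂ d₁))))
    case (inj₂ x<m₂) = inj₂ (m₂ , x<m₂ , <-respʳ-≃ (s*m/s r′ c 0<c) (ℚ.*-monoʳ-<-pos c {{positive 0<c}} (proj₂ (proj₂ d₂))))
  ... | no 0≮c = case (r ℚ.<? 0ℚᵘ)
    where
    c≃0 : c ≃ 0ℚᵘ
    c≃0 = ℚ.≤-antisym (ℚ.≮⇒≥ 0≮c) (ℚ.nonNegative⁻¹ c)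
    0≃cp : ∀ p → 0ℚᵘ ≃ c * p
    0≃cp p = ≃-sym (≃-trans (ℚ.*-congʳ {p} c≃0) (ℚ.*-zeroˡ p))
    case : Dec (r < 0ℚᵘ) → _
    case (yes r<0) = let p , p<x = lower-inhabited x in inj₁ (p , p<x , <-respʳ-≃ (0≃cp p) r<0)
    case (no  r≮0) = let q , x<q = upper-inhabited x in
      inj₂ (q , x<q , <-respˡ-≃ (0≃cp q) (≤-<-trans (ℚ.≮⇒≥ r≮0) r<r′))

·-pos : ∀ c .{{_ : NonNegative c}} x → 0ℚᵘ < c → Pos x → Pos (c · x)
·-pos c x 0<c 0<x = let p , 0<p , p<x = lower-open x 0<x in
  p , p<x , <-respˡ-≃ (ℚ.*-zeroʳ c) (ℚ.*-monoʳ-<-pos c {{positive 0<c}} 0<p)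

recip : (x : ℝ) → Pos x → ℝ
recip x 0<x = record
  { Lower = L
  ; Upper = U
  ; lower-inhabited = let s , x<s = upper-inhabited x in 0ℚᵘ , s , x<s , <-respˡ-≃ (≃-sym (ℚ.*-zeroˡ s)) 0<1
  ; upper-inhabited = let s , 0<s , s<x = lower-open x 0<x in
      (1ℚᵘ + 1ℚᵘ) * 1/⁺ s 0<s , s , 0<s , s<x , <-respʳ-≃ (≃-sym (m/s*s (1ℚᵘ + 1ℚᵘ) s 0<s)) (p<p+1 1ℚᵘ)
  ; lower-down = λ { {r} {r′} r<r′ (s , x<s , r′s<1) → s , x<s ,
      <-trans {r * s} {r′ * s} (ℚ.*-monoˡ-<-pos s {{positive (lower<upper x 0<x x<s)}} r<r′) r′s<1 }
  ; lower-open = λ { {r} (s , x<s , rs<1) →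
      let m , rs<m , m<1 = <-dense rs<1
          0<s = lower<upper x 0<x x<s
          rs<m′ = <-respʳ-≃ (≃-sym (m/s*s m s 0<s)) rs<m
      in m * 1/⁺ s 0<s
         , ℚ.*-cancelʳ-<-nonNeg s {{nonNegative (<⇒≤ 0<s)}} rs<m′
         , s , x<s , <-respˡ-≃ (≃-sym (m/s*s m s 0<s)) m<1 }
  ; upper-up = λ { r<r′ (s , 0<s , s<x , 1<rs) → s , 0<s , s<x ,
      <-trans 1<rs (ℚ.*-monoˡ-<-pos s {{positive 0<s}} r<r′) }
  ; upper-open = λ { {r} (s , 0<s , s<x , 1<rs) →
      let m , 1<m , m<rs = <-dense 1<rs
          m<rs′ = <-respˡ-≃ (≃-sym (m/s*s m s 0<s)) m<rs
      in m * 1/⁺ s 0<s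
         , ℚ.*-cancelʳ-<-nonNeg s {{nonNegative (<⇒≤ 0<s)}} m<rs′
         , s , 0<s , s<x , <-respʳ-≃ (≃-sym (m/s*s m s 0<s)) 1<m }
  ; disjoint = λ {r} → disj {r}
  ; located = λ {r} {r′} → loc {r} {r′}
  }
  where
  L U : ℚᵘ → Set
  L r = ∃ λ s → Upper x s × r * s < 1ℚᵘ
  U r = ∃ λ s → 0ℚᵘ < s × Lower x s × 1ℚᵘ < r * s

  disj : ∀ {r} → L r → U r → ⊥
  disj {r} (s , x<s , rs<1) (s′ , 0<s′ , s′<x , 1<rs′) = ℚ.<-irrefl ℚ.≃-refl
    (<-trans 1<rs′ (<-trans (ℚ.*-monoʳ-<-pos r {{positive 0<r}} (lower<upper x s′<x x<s)) rs<1))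
    where
    0<r : 0ℚᵘ < r
    0<r = ℚ.*-cancelʳ-<-nonNeg s′ {{nonNegative (<⇒≤ 0<s′)}}
            (<-respˡ-≃ (≃-sym (ℚ.*-zeroˡ s′)) (<-trans 0<1 1<rs′))

  loc : ∀ {r r′} → r < r′ → L r ⊎ U r′
  loc {r} {r′} r<r′ with 0ℚᵘ ℚ.<? r
  ... | no 0≮r = let s , x<s = upper-inhabited x in
    inj₁ (s , x<s , ≤-<-trans
      (ℚ.*-monoˡ-≤-nonNeg s {{nonNegative (<⇒≤ (lower<upper x 0<x x<s))}} (ℚ.≮⇒≥ 0≮r))
      (<-respˡ-≃ (≃-sym (ℚ.*-zeroˡ s)) 0<1))
  ... | yes 0<r = case (located x m₁<m₂)
    where
    0<r′ : 0ℚᵘ < r′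
    0<r′ = <-trans 0<r r<r′
    a<b : 1/⁺ r′ 0<r′ < 1/⁺ r 0<r
    a<b = ℚ.*-cancelˡ-<-nonNeg r′ {{nonNegative (<⇒≤ 0<r′)}}
      (<-respˡ-≃ (≃-trans (s*1/s r 0<r) (≃-sym (s*1/s r′ 0<r′)))
        (ℚ.*-monoˡ-<-pos (1/⁺ r 0<r) {{1/s>0 r 0<r}} r<r′))
    d₁ = <-dense a<b
    m₁ = proj₁ d₁
    d₂ = <-dense (proj₂ (proj₂ d₁))
    m₂ = proj₁ d₂
    m₁<m₂ : m₁ < m₂
    m₁<m₂ = proj₁ (proj₂ d₂)
    case : Lower x m₁ ⊎ Upper x m₂ → _
    case (inj₁ m₁<x) = inj₂ (m₁ , <-trans (ℚ.positive⁻¹ (1/⁺ r′ 0<r′) {{1/s>0 r′ 0<r′}}) (proj₁ (proj₂ d₁)) , m₁<x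
      , <-respˡ-≃ (s*1/s r′ 0<r′) (ℚ.*-monoʳ-<-pos r′ {{positive 0<r′}} (proj₁ (proj₂ d₁))))
    case (inj₂ x<m₂) = inj₁ (m₂ , x<m₂
      , <-respʳ-≃ (s*1/s r 0<r) (ℚ.*-monoʳ-<-pos r {{positive 0<r}} (proj₂ (proj₂ d₂))))

infixl 6 _÷_[_]

_÷_[_] : (a : ℚᵘ) .{{_ : NonNegative a}} (x : ℝ) → Pos x → ℝ
a ÷ x [ 0<x ] = a · recip x 0<x

-- Comparison of 2 ^ z with m for an integer z; negative powers are cleared to the other side.
infix 4 2^_<_ _<2^_

2^_<_ : ℤ → ℕ → Set
2^ + k       < m = 2 ^ k ℕ.< m
2^ -[1+ k ]  < m = 1 ℕ.< m ℕ.* 2 ^ suc k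

_<2^_ : ℕ → ℤ → Set
m <2^ + k      = m ℕ.< 2 ^ k
m <2^ -[1+ k ] = m ℕ.* 2 ^ suc k ℕ.< 1

private
  n<2^n : ∀ n → n ℕ.< 2 ^ n
  n<2^n zero    = s≤s z≤n
  n<2^n (suc n) = ℕ.≤-trans (ℕ.+-mono-≤ (ℕ.m^n>0 2 n) (n<2^n n)) (ℕ.≤-reflexive (cong (2 ^ n ℕ.+_) (sym (ℕ.+-identityʳ _))))

  ^-cancelˡ-< : ∀ n {x y} → x ^ n ℕ.< y ^ n → x ℕ.< y
  ^-cancelˡ-< n {x} {y} xⁿ<yⁿ with x ℕ.<? y
  ... | yes x<y = x<y
  ... | no  x≮y = ⊥-elim (ℕ.<⇒≱ xⁿ<yⁿ (ℕ.^-monoˡ-≤ n (ℕ.≮⇒≥ x≮y)))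

  ^-swap : ∀ x m n → (x ^ m) ^ n ≡ (x ^ n) ^ m
  ^-swap x m n = trans (ℕ.^-*-assoc x m n) (trans (cong (x ^_) (ℕ.*-comm m n)) (sym (ℕ.^-*-assoc x n m)))

  bernoulli : ∀ u n → u ^ n ℕ.* (u ℕ.+ n) ℕ.≤ suc u ^ n ℕ.* u
  bernoulli u zero    = ℕ.≤-reflexive (cong (1 ℕ.*_) (ℕ.+-identityʳ u))
  bernoulli u (suc n) = begin
    u ℕ.* a ℕ.* (u ℕ.+ suc n)                ≡⟨ solve 3 (λ u a n → u :* a :* (u :+ (con 1 :+ n)) := u :* (a :* (u :+ n)) :+ a :* u) refl u a n ⟩
    u ℕ.* (a ℕ.* (u ℕ.+ n)) ℕ.+ a ℕ.* u      ≤⟨ ℕ.+-mono-≤ (ℕ.*-monoʳ-≤ u (bernoulli u n)) (ℕ.*-monoˡ-≤ u (ℕ.^-monoˡ-≤ n (ℕ.n≤1+n u))) ⟩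
    u ℕ.* (b ℕ.* u) ℕ.+ b ℕ.* u              ≡⟨ solve 2 (λ u b → u :* (b :* u) :+ b :* u := (con 1 :+ u) :* b :* u) refl u b ⟩
    suc u ℕ.* b ℕ.* u                        ∎
    where
    open ℕ.≤-Reasoning
    open +-*-Solver
    a = u ^ n
    b = suc u ^ n

  double< : ∀ {u v} → 1 ℕ.≤ u → u ℕ.< v → ∃ λ n → 2 ℕ.* u ^ suc n ℕ.< v ^ suc n
  double< {suc u′} {v} _ u<v = u′ ℕ.+ suc (u′ ℕ.+ 0) , ℕ.<-≤-trans (ℕ.*-cancelʳ-< u _ _ lt) (ℕ.^-monoˡ-≤ N u<v)
    where
    open ℕ.≤-Reasoning
    open +-*-Solver
    u = suc u′
    N = 2 ℕ.* u
    instance _ = ℕ.m^n≢0 u N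
    lt : 2 ℕ.* u ^ N ℕ.* u ℕ.< suc u ^ N ℕ.* u
    lt = begin-strict
      2 ℕ.* u ^ N ℕ.* u             <⟨ ℕ.m<m+n (2 ℕ.* u ^ N ℕ.* u) (ℕ.*-mono-≤ (ℕ.m^n>0 u N) (s≤s {n = u′} z≤n)) ⟩
      2 ℕ.* u ^ N ℕ.* u ℕ.+ u ^ N ℕ.* u ≡⟨ solve 2 (λ a u → con 2 :* a :* u :+ a :* u := a :* (u :+ con 2 :* u)) refl (u ^ N) u ⟩
      u ^ N ℕ.* (u ℕ.+ N)           ≤⟨ bernoulli u N ⟩
      suc u ^ N ℕ.* u               ∎

  cross< : ∀ {k b w c} → mkℚᵘ (+ k) b < mkℚᵘ (+ w) c → k ℕ.* suc c ℕ.< w ℕ.* suc b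
  cross< {k} {b} {w} {c} (*<* lt) = ℤ.drop‿+<+ (subst₂ ℤ._<_ (sym (ℤ.pos-* k (suc c))) (sym (ℤ.pos-* w (suc b))) lt)

  mk< : ∀ {k b w c} → k ℕ.* suc c ℕ.< w ℕ.* suc b → mkℚᵘ (+ k) b < mkℚᵘ (+ w) c
  mk< {k} {b} {w} {c} lt = *<* (subst₂ ℤ._<_ (ℤ.pos-* k (suc c)) (ℤ.pos-* w (suc b)) (ℤ.+<+ lt))

  nonneg≮neg : ∀ {k b w c} → mkℚᵘ (+ k) b < mkℚᵘ -[1+ w ] c → ⊥
  nonneg≮neg {k} {b} {w} {c} (*<* lt) with subst (ℤ._< (-[1+ w ] ℤ.* + suc b)) (sym (ℤ.pos-* k (suc c))) lt
  ... | ()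

log₂ : (n : ℕ) → 1 ℕ.≤ n → ℝ
log₂ n 1≤n = record
  { Lower = L
  ; Upper = U
  ; lower-inhabited = mkℚᵘ -[1+ 0 ] 0 , neg<log 0 0
  ; upper-inhabited = mkℚᵘ (+ n) 0 , subst (ℕ._< 2 ^ n) (sym (ℕ.*-identityʳ n)) (n<2^n n)
  ; lower-down = λ {p} {q} → down p q
  ; lower-open = λ {p} → open-L p
  ; upper-up = λ {p} {q} → up p q
  ; upper-open = λ {q} → open-U q
  ; disjoint = λ {p} → disj p
  ; located = λ {p} {q} → loc p q
  }
  where
  -- z / b < log₂ n  iff  2 ^ z < n ^ b;   log₂ n < z / b  iff  n ^ b < 2 ^ z
  L U : ℚᵘ → Set
  L r = 2^ ℚᵘ.numerator r < n ^ ℚᵘ.denominatorℕ r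
  U r = n ^ ℚᵘ.denominatorℕ r <2^ ℚᵘ.numerator r

  instance _ = ℕ.>-nonZero 1≤n

  2≤2^ : ∀ k b → 2 ℕ.≤ n ^ b ℕ.* 2 ^ suc k
  2≤2^ k b = ℕ.*-mono-≤ (ℕ.m^n>0 n b) (ℕ.*-monoʳ-≤ 2 (ℕ.m^n>0 2 k))

  neg<log : ∀ k b → L (mkℚᵘ -[1+ k ] b)
  neg<log k b = 2≤2^ k (suc b)

  log≮neg : ∀ k b → ¬ U (mkℚᵘ -[1+ k ] b)
  log≮neg k b lt = ℕ.<⇒≱ lt (ℕ.<⇒≤ (2≤2^ k (suc b)))

  open ℕ.≤-Reasoning

  down : ∀ p q → p < q → L q → L p
  down (mkℚᵘ -[1+ k ] b) _ _ _ = neg<log k b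
  down (mkℚᵘ (+ k) b) (mkℚᵘ -[1+ w ] c) p<q _ = ⊥-elim (nonneg≮neg p<q)
  down (mkℚᵘ (+ k) b) (mkℚᵘ (+ w) c) p<q lt = ^-cancelˡ-< (suc c) (begin-strict
    (2 ^ k) ^ suc c     ≡⟨ ℕ.^-*-assoc 2 k (suc c) ⟩
    2 ^ (k ℕ.* suc c)   ≤⟨ ℕ.^-monoʳ-≤ 2 (ℕ.<⇒≤ (cross< p<q)) ⟩
    2 ^ (w ℕ.* suc b)   ≡⟨ ℕ.^-*-assoc 2 w (suc b) ⟨
    (2 ^ w) ^ suc b     <⟨ ℕ.^-monoˡ-< (suc b) lt ⟩
    (n ^ suc c) ^ suc b ≡⟨ ^-swap n (suc c) (suc b) ⟩
    (n ^ suc b) ^ suc c ∎)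

  up : ∀ p q → p < q → U p → U q
  up (mkℚᵘ -[1+ k ] b) _ _ lt = ⊥-elim (log≮neg k b lt)
  up (mkℚᵘ (+ k) b) (mkℚᵘ -[1+ w ] c) p<q _ = ⊥-elim (nonneg≮neg p<q)
  up (mkℚᵘ (+ k) b) (mkℚᵘ (+ w) c) p<q lt = ^-cancelˡ-< (suc b) (begin-strict
    (n ^ suc c) ^ suc b ≡⟨ ^-swap n (suc c) (suc b) ⟩
    (n ^ suc b) ^ suc c <⟨ ℕ.^-monoˡ-< (suc c) lt ⟩
    (2 ^ k) ^ suc c     ≡⟨ ℕ.^-*-assoc 2 k (suc c) ⟩
    2 ^ (k ℕ.* suc c)   ≤⟨ ℕ.^-monoʳ-≤ 2 (ℕ.<⇒≤ (cross< p<q)) ⟩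
    2 ^ (w ℕ.* suc b)   ≡⟨ ℕ.^-*-assoc 2 w (suc b) ⟨
    (2 ^ w) ^ suc b     ∎)

  loc : ∀ p q → p < q → L p ⊎ U q
  loc (mkℚᵘ -[1+ k ] b) _ _ = inj₁ (neg<log k b)
  loc (mkℚᵘ (+ k) b) (mkℚᵘ -[1+ w ] c) p<q = ⊥-elim (nonneg≮neg p<q)
  loc (mkℚᵘ (+ k) b) (mkℚᵘ (+ w) c) p<q with 2 ^ k ℕ.<? n ^ suc b
  ... | yes lt = inj₁ lt
  ... | no  ge = inj₂ (^-cancelˡ-< (suc b) (begin-strict
    (n ^ suc c) ^ suc b ≡⟨ ^-swap n (suc c) (suc b) ⟩
    (n ^ suc b) ^ suc c ≤⟨ ℕ.^-monoˡ-≤ (suc c) (ℕ.≮⇒≥ ge) ⟩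
    (2 ^ k) ^ suc c     ≡⟨ ℕ.^-*-assoc 2 k (suc c) ⟩
    2 ^ (k ℕ.* suc c)   <⟨ ℕ.^-monoʳ-< 2 (s≤s (s≤s z≤n)) (cross< p<q) ⟩
    2 ^ (w ℕ.* suc b)   ≡⟨ ℕ.^-*-assoc 2 w (suc b) ⟨
    (2 ^ w) ^ suc b     ∎))

  disj : ∀ p → L p → U p → ⊥
  disj (mkℚᵘ -[1+ k ] b) _  gt = log≮neg k b gt
  disj (mkℚᵘ (+ k) b)    lt gt = ℕ.<-asym lt gt

  open-L : ∀ p → L p → ∃ λ q → p < q × L q
  open-L p@(mkℚᵘ -[1+ k ] b) _ = between (<-dense {p} {0ℚᵘ} (*<* ℤ.-<+))
    where
    between : (∃ λ m → p < m × m < 0ℚᵘ) → ∃ λ q → p < q × L q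
    between (mkℚᵘ -[1+ j ] c , p<m , _)  = _ , p<m , neg<log j c
    between (mkℚᵘ (+ j) c , _ , m<0) with cross< {j} {c} {0} {0} m<0
    ... | ()
  open-L (mkℚᵘ (+ k) b) lt with double< (ℕ.m^n>0 2 k) lt
  ... | N-1 , lt′ = mkℚᵘ (+ suc (k ℕ.* N)) (N-1 ℕ.+ b ℕ.* N)
    , mk< (begin-strict
        k ℕ.* (suc b ℕ.* N)           ≡⟨ solve 3 (λ k b N → k :* (b :* N) := k :* N :* b) refl k (suc b) N ⟩
        k ℕ.* N ℕ.* suc b             <⟨ ℕ.m<n+m _ (s≤s z≤n) ⟩
        suc (k ℕ.* N) ℕ.* suc b       ∎)
    , (begin-strict
        2 ^ suc (k ℕ.* N)             ≡⟨ cong (2 ℕ.*_) (ℕ.^-*-assoc 2 k N) ⟨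
        2 ℕ.* (2 ^ k) ^ N             <⟨ lt′ ⟩
        (n ^ suc b) ^ N               ≡⟨ ℕ.^-*-assoc n (suc b) N ⟩
        n ^ (suc b ℕ.* N)             ∎)
    where
    N = suc N-1
    open +-*-Solver

  open-U : ∀ q → U q → ∃ λ p → p < q × U p
  open-U (mkℚᵘ -[1+ k ] b) lt = ⊥-elim (log≮neg k b lt)
  open-U (mkℚᵘ (+ zero) b) lt = ⊥-elim (ℕ.<⇒≱ lt (ℕ.m^n>0 n (suc b)))
  open-U (mkℚᵘ (+ suc k) b) lt with double< (ℕ.m^n>0 n (suc b)) lt
  ... | N-1 , lt′ = mkℚᵘ (+ j) (N-1 ℕ.+ b ℕ.* N)
    , mk< (begin-strict
        j ℕ.* suc b                     <⟨ ℕ.m<n+m _ (s≤s z≤n) ⟩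
        suc k ℕ.* N ℕ.* suc b           ≡⟨ solve 3 (λ k b N → k :* N :* b := k :* (b :* N)) refl (suc k) (suc b) N ⟩
        suc k ℕ.* (suc b ℕ.* N)         ∎)
    , ℕ.*-cancelˡ-< 2 _ _ (begin-strict
        2 ℕ.* n ^ (suc b ℕ.* N)         ≡⟨ cong (2 ℕ.*_) (ℕ.^-*-assoc n (suc b) N) ⟨
        2 ℕ.* (n ^ suc b) ^ N           <⟨ lt′ ⟩
        (2 ^ suc k) ^ N                 ≡⟨ ℕ.^-*-assoc 2 (suc k) N ⟩
        2 ℕ.* 2 ^ j                     ∎)
    where
    N = suc N-1
    j = N-1 ℕ.+ k ℕ.* N
    open +-*-Solver

log₂-pos : ∀ n (1≤n : 1 ℕ.≤ n) → 2 ℕ.≤ n → Pos (log₂ n 1≤n)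
log₂-pos n _ 2≤n = subst (1 ℕ.<_) (sym (ℕ.*-identityʳ n)) 2≤n

-- f t → ℓ as t → ∞, for f defined from t₀ on and a rational limit ℓ: eventually ℓ - ε < f t < ℓ + ε.
Tendsto : (t₀ : ℕ) → ((t : ℕ) → t₀ ℕ.≤ t → ℝ) → ℚᵘ → Set
Tendsto t₀ f ℓ = ∀ ε → 0ℚᵘ < ε → ∃ λ T → ∀ t (t₀≤t : t₀ ℕ.≤ t) → T ℕ.≤ t →
  Lower (f t t₀≤t) (ℓ - ε) × Upper (f t t₀≤t) (ℓ + ε)

½d·t·log₂ : (d t : ℕ) → 2 ℕ.≤ t → ℝ
½d·t·log₂ d t 2≤t = (+ d / 2) · (+ t / 1) · log₂ t (ℕ.<⇒≤ 2≤t)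

½d·t·log₂-pos : ∀ d t → 2 ℕ.≤ d → (2≤t : 2 ℕ.≤ t) → Pos (½d·t·log₂ d t 2≤t)
½d·t·log₂-pos d@(suc _) t@(suc _) _ 2≤t =
  ·-pos (+ d / 2) ((+ t / 1) · log₂ t 1≤t) (ℚ.positive⁻¹ (+ d / 2))
    (·-pos (+ t / 1) (log₂ t 1≤t) (ℚ.positive⁻¹ (+ t / 1)) (log₂-pos t 1≤t 2≤t))
  where 1≤t = ℕ.<⇒≤ 2≤t

{-# OPTIONS --safe #-}
module Submission where

-- A clique covering of K t d with n cliques gives, for every part i and symbol a, the set A(i,a) ⊆ [n] of cliques
-- through the a-th vertex of part i; sets of the same part are disjoint, sets of different parts intersect.
--
-- Lower bound: for a ≠ b the subcubes of {0,1}ⁿ that are 1 on A(i,a) and 0 on A(i,b) are disjoint for distinct i,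
-- so Σᵢ 2^-(|A(i,a)| + |A(i,b)|) ≤ 1 and |A(i,a)| + |A(i,b)| is about log₂ t at least on average; now sum over a cycle of symbols.
--
-- Upper bound (after Gargano, Körner and Vaccaro): t words of length n over d symbols, any two of which show every
-- pair of symbols (a,b) in some position, give a covering of weight at most n t. For one pair (a,b) take words using
-- every symbol s times and classify them by the word obtained on replacing b by a: each class has (2s choose s) ≈ 4^s
-- members, and two distinct members show (a,b). To treat several pairs without losing rate, take L blocks and link
-- the class of each block for one pair to the class of the next block for another pair; see chain.

open import Defs using (Graph; K; IsClique; CliqueCovering; scc; scc-exists; Tendsto; _÷_[_]; ½d·t·log₂; ½d·t·log₂-pos; module ℝ)
import Algebra.Properties.CommutativeMonoid.Sum
open import Data.Bool using (Bool; true; false; not; if_then_else_)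
import Data.Bool.Properties as Bool
open import Data.Empty using (⊥; ⊥-elim)
open import Data.Fin using (Fin; zero; suc; toℕ; fromℕ; inject₁; inject≤; _≟_; _↑ˡ_; _↑ʳ_; splitAt; combine; remQuot; quotient; remainder)
import Data.Fin.Properties as Fin
open import Data.Fin.Subset as Subset using (Subset; ∣_∣)
import Data.Integer as ℤ
import Data.Integer.Properties as ℤ
open import Data.List as List using (List; []; _∷_; _++_; length; map; replicate; filter; deduplicate; allFin; cartesianProduct)
open import Data.List.Membership.Propositional using (_∈_; lose)
open import Data.List.Membership.Propositional.Properties using (∈-lookup; ∈-filter⁺; ∈-filter⁻; ∈-allFin; ∈-map⁺; ∈-map⁻; ∈-++⁻; ∈-tabulate⁺; ∈-tabulate⁻; ∈-deduplicate⁺; ∈-deduplicate⁻; ∈-cartesianProduct⁺)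
open import Data.List.Membership.Setoid.Properties using (index-injective)
import Data.List.Properties as List
open import Data.List.Relation.Binary.Disjoint.Propositional using (Disjoint)
open import Data.List.Relation.Unary.All as All using (All; []; _∷_)
open import Data.List.Relation.Unary.AllPairs using (AllPairs; []; _∷_)
import Data.List.Relation.Unary.AllPairs.Properties as AllPairs
open import Data.List.Relation.Unary.Any as Any using (here; there; index)
open import Data.List.Relation.Unary.Any.Properties using (lookup-index)
open import Data.List.Relation.Unary.Unique.DecPropositional.Properties using (deduplicate-!)
open import Data.List.Relation.Unary.Unique.Propositional using (Unique)
import Data.List.Relation.Unary.Unique.Propositional.Properties as Unique
open import Data.Maybe using (Maybe; just; nothing)
open import Data.Nat as ℕ using (ℕ; zero; suc; pred; _+_; _*_; _∸_; _^_; _!; _≤_; _<_; _≤?_; _<?_; z≤n; s≤s; NonZero; >-nonZero; >-nonZero⁻¹)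
open import Data.Nat.DivMod using (_%_; _mod_; %-distribˡ-+; [m+n]%n≡m%n; m<n⇒m%n≡m; m%n%n≡m%n; m%n<n; m≡m%n+[m/n]*n; m/n*n≤m; m*n/n≡m; /-monoˡ-≤)
open import Data.Nat.ListAction using (sum)
import Data.Nat.Properties as ℕ
open import Data.Nat.Properties using (_!≢0)
open import Data.Nat.Tactic.RingSolver using (solve-∀)
open import Data.Product using (∃; ∃₂; _×_; _,_; proj₁; proj₂)
open import Data.Rational.Unnormalised as ℚᵘ using (ℚᵘ; mkℚᵘ; 1ℚᵘ; _/_; *<*)
import Data.Rational.Unnormalised.Properties as ℚᵘ
open import Data.Sum using (_⊎_; inj₁; inj₂; [_,_]′)
open import Data.Vec as Vec using (Vec; []; _∷_; lookup; count)
import Data.Vec.Properties as Vec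
open import Function using (_∘_; id)
open import Function.Definitions using (Injective)
open import Relation.Binary using (DecidableEquality)
open import Relation.Binary.PropositionalEquality using (_≡_; _≢_; refl; sym; trans; cong; cong₂; subst; subst₂; setoid; module ≡-Reasoning)
open import Relation.Nullary using (Dec; yes; no; does)
open import Relation.Nullary.Decidable using (dec-true)

open Algebra.Properties.CommutativeMonoid.Sum ℕ.+-0-commutativeMonoid using (sum-cong-≗; ∑-distrib-+; ∑-comm; sum-init-last; sum-replicate-zero) renaming (sum to ∑)

-- Words as numbers, and addition modulo n.

encode : ∀ {m k} → Vec (Fin m) k → Fin (m ^ k)
encode []       = zero
encode (i ∷ is) = combine i (encode is)

decode : ∀ {m} k → Fin (m ^ k) → Vec (Fin m) k
decode zero    _ = []
decode {m} (suc k) i = let j , r = remQuot {m} (m ^ k) i in j ∷ decode k r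

decode-encode : ∀ {m k} (is : Vec (Fin m) k) → decode k (encode is) ≡ is
decode-encode []       = refl
decode-encode {m} {suc k} (i ∷ is) = trans
  (cong (λ (j , r) → j ∷ decode k r) (Fin.remQuot-combine {m} {m ^ k} i (encode is)))
  (cong (i ∷_) (decode-encode is))

encode-decode : ∀ {m} k (i : Fin (m ^ k)) → encode (decode k i) ≡ i
encode-decode zero    zero = refl
encode-decode {m} (suc k) i = trans (cong (combine (proj₁ (remQuot {m} (m ^ k) i))) (encode-decode k _)) (Fin.combine-remQuot {m} (m ^ k) i)

decode-injective : ∀ {m} k {i j : Fin (m ^ k)} → decode k i ≡ decode k j → i ≡ j
decode-injective k {i} {j} eq = trans (sym (encode-decode k i)) (trans (cong encode eq) (encode-decode k j))

encode-injective : ∀ {m k} {is js : Vec (Fin m) k} → encode is ≡ encode js → is ≡ js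
encode-injective {k = k} {is} {js} eq = trans (sym (decode-encode is)) (trans (cong (decode k) eq) (decode-encode js))

infixl 6 _⊕_

-- Combines two labels into one link. What matters is cancellation on both sides: a sum and one of
-- its summands determine the other summand.
_⊕_ : ∀ {n} → Fin n → Fin n → Fin n
_⊕_ {suc _} i j = (toℕ i + toℕ j) mod suc _

⊕-cancelʳ : ∀ {n} (i j k : Fin n) → i ⊕ k ≡ j ⊕ k → i ≡ j
⊕-cancelʳ {n@(suc _)} i j k eq = Fin.toℕ-injective (trans (sym (undo i)) (trans (cong (λ m → (m + (n ∸ toℕ k)) % n) eq′) (undo j)))
  where
  open ≡-Reasoning
  eq′ : (toℕ i + toℕ k) % n ≡ (toℕ j + toℕ k) % n
  eq′ = trans (sym (Fin.toℕ-fromℕ< _)) (trans (cong toℕ eq) (Fin.toℕ-fromℕ< _))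
  undo : ∀ (l : Fin n) → ((toℕ l + toℕ k) % n + (n ∸ toℕ k)) % n ≡ toℕ l
  undo l = begin
    ((toℕ l + toℕ k) % n + (n ∸ toℕ k)) % n             ≡⟨ %-distribˡ-+ ((toℕ l + toℕ k) % n) (n ∸ toℕ k) n ⟩
    ((toℕ l + toℕ k) % n % n + (n ∸ toℕ k) % n) % n     ≡⟨ cong (λ m → (m + (n ∸ toℕ k) % n) % n) (m%n%n≡m%n (toℕ l + toℕ k) n) ⟩
    ((toℕ l + toℕ k) % n + (n ∸ toℕ k) % n) % n         ≡⟨ %-distribˡ-+ (toℕ l + toℕ k) (n ∸ toℕ k) n ⟨
    (toℕ l + toℕ k + (n ∸ toℕ k)) % n                   ≡⟨ cong (_% n) (ℕ.+-assoc (toℕ l) (toℕ k) _) ⟩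
    (toℕ l + (toℕ k + (n ∸ toℕ k))) % n                 ≡⟨ cong (λ m → (toℕ l + m) % n) (ℕ.m+[n∸m]≡n (ℕ.<⇒≤ (Fin.toℕ<n k))) ⟩
    (toℕ l + n) % n                                     ≡⟨ [m+n]%n≡m%n (toℕ l) n ⟩
    toℕ l % n                                           ≡⟨ m<n⇒m%n≡m (Fin.toℕ<n l) ⟩
    toℕ l                                               ∎

⊕-cancelˡ : ∀ {n} (i j k : Fin n) → k ⊕ i ≡ k ⊕ j → i ≡ j
⊕-cancelˡ {suc _} i j k eq = ⊕-cancelʳ i j k (trans (⊕-comm i k) (trans eq (⊕-comm k j)))
  where
  ⊕-comm : ∀ i j → i ⊕ j ≡ j ⊕ i
  ⊕-comm i j = cong (_mod suc _) (ℕ.+-comm (toℕ i) (toℕ j))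

-- Codes, labellings and the chaining of labellings.

Code : (d T n : ℕ) → Set
Code d T n = Fin T → Fin n → Fin d

module _ {d T n : ℕ} (c : Code d T n) where

  Meets : Fin d → Fin d → Fin T → Fin T → Set
  Meets a b x y = ∃ λ p → c x p ≡ a × c y p ≡ b

  Separating : ∀ {N} → (Fin d → Fin d → Set) → (Fin T → Fin N) → Set
  Separating P f = ∀ {x y} → x ≢ y → f x ≡ f y → ∀ {a b} → P a b → Meets a b x y

  -- By pigeonhole some label is shared by at least T / N words, and these form a code showing every
  -- pair of `P`. Hence the aim is to keep N small against T.
  Labelling : ℕ → (Fin d → Fin d → Set) → Set
  Labelling N P = ∃ λ (f : Fin T → Fin N) → Separating P f

  -- The concatenations of L words of `c`. Length and logarithm of the size both grow by the factor
  -- L, so the rate does not change.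
  power : ∀ L → Code d (T ^ L) (L * n)
  power L x p = let k , q = remQuot {L} n p in c (lookup (decode L x) k) q

power-meets : ∀ {d T n} (c : Code d T n) {L} {x y : Fin (T ^ L)} {a b} k →
  Meets c a b (lookup (decode L x) k) (lookup (decode L y) k) → Meets (power c L) a b x y
power-meets {n = n} c {L} {x} {y} k (q , xq≡a , yq≡b) = combine k q ,
  trans (at x) xq≡a , trans (at y) yq≡b
  where
  at : ∀ x → power c L x (combine k q) ≡ c (lookup (decode L x) k) q
  at x = cong (λ (k , q) → c (lookup (decode L x) k) q) (Fin.remQuot-combine {L} {n} k q)

lookup-≢ : ∀ {A : Set} {n} → (∀ (x y : A) → Dec (x ≡ y)) → {xs ys : Vec A n} → xs ≢ ys → ∃ λ k → lookup xs k ≢ lookup ys k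
lookup-≢ _≟_ {[]}     {[]}     xs≢ys = ⊥-elim (xs≢ys refl)
lookup-≢ _≟_ {x ∷ xs} {y ∷ ys} xs≢ys with x ≟ y
... | no x≢y   = zero , x≢y
... | yes refl = let k , neq = lookup-≢ _≟_ (xs≢ys ∘ cong (x ∷_)) in suc k , neq

FullySeparating : ∀ {d T n} → Code d T n → Set
FullySeparating c = ∀ x y → x ≢ y → ∀ a b → Meets c a b x y

power-separating : ∀ {d T n} (c : Code d T n) L → FullySeparating c → FullySeparating (power c L)
power-separating c L separating x y x≢y a b =
  let k , neq = lookup-≢ Fin._≟_ (x≢y ∘ decode-injective L) in power-meets c k (separating _ _ neq a b)

module _ {T N : ℕ} (f g : Fin T → Fin N) where

  -- The L + 1 sums `z ⊕ f x₁`, `g x₁ ⊕ f x₂`, ..., closed by `g x_L` alone: each inner link serves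
  -- the `g`-label of one block and the `f`-label of the next.
  links : ∀ {L} → Fin N → Vec (Fin T) L → Vec (Fin N) (suc L)
  links z []       = z ∷ []
  links z (x ∷ xs) = z ⊕ f x ∷ links (g x) xs

  links-first : ∀ {L} z (xs ys : Vec (Fin T) L) → xs ≢ ys → links z xs ≡ links z ys →
    ∃ λ k → lookup xs k ≢ lookup ys k × f (lookup xs k) ≡ f (lookup ys k)
  links-first z []       []       xs≢ys eq = ⊥-elim (xs≢ys refl)
  links-first z (x ∷ xs) (y ∷ ys) xs≢ys eq with x Fin.≟ y
  ... | no x≢y   = zero , x≢y , ⊕-cancelˡ _ _ z (Vec.∷-injectiveˡ eq)
  ... | yes refl = let k , r = links-first (g x) xs ys (xs≢ys ∘ cong (x ∷_)) (Vec.∷-injectiveʳ eq) in suc k , r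

  -- The induction starts from the right end, where the incoming values may still differ, hence the
  -- separate z and z′. If the tails agree then `g x ≡ g y`; now either x ≠ y is the last
  -- difference, or x = y and cancelling `f x` gives z = z′.
  links-last : ∀ {L} z z′ (xs ys : Vec (Fin T) L) → links z xs ≡ links z′ ys →
    (xs ≡ ys × z ≡ z′) ⊎ ∃ λ k → lookup xs k ≢ lookup ys k × g (lookup xs k) ≡ g (lookup ys k)
  links-last z z′ []       []       eq = inj₁ (refl , Vec.∷-injectiveˡ eq)
  links-last z z′ (x ∷ xs) (y ∷ ys) eq with links-last (g x) (g y) xs ys (Vec.∷-injectiveʳ eq)
  ... | inj₂ (k , r)       = inj₂ (suc k , r)
  ... | inj₁ (refl , gx≡gy) with x Fin.≟ y
  ...   | no x≢y   = inj₂ (zero , x≢y , gx≡gy)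
  ...   | yes refl = inj₁ (refl , ⊕-cancelʳ z z′ (f x) (Vec.∷-injectiveˡ eq))

-- If two words with the same links differ, then f agrees on them at the first block where they differ,
-- and g at the last one. There are only L + 1 links, against L for a labelling that serves P alone.
chain : ∀ {d T n N} (c : Code d T n) {P Q : Fin d → Fin d → Set} .{{_ : NonZero N}} L →
  Labelling c N P → Labelling c N Q → Labelling (power c L) (N ^ suc L) (λ a b → P a b ⊎ Q a b)
chain {N = N} c L (f , f-sep) (g , g-sep) = label , separating
  where
  z : Fin N
  z = 0 mod N
  label = λ x → encode (links f g z (decode L x))
  separating : Separating (power c L) _ label
  separating {x} {y} x≢y eq (inj₁ pab) =
    let k , neq , fk = links-first f g z _ _ (x≢y ∘ decode-injective L) (encode-injective eq)
    in power-meets c k (f-sep neq fk pab)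
  separating {x} {y} x≢y eq (inj₂ qab) with links-last f g z z (decode L x) (decode L y) (encode-injective eq)
  ... | inj₁ (xs≡ys , _)  = ⊥-elim (x≢y (decode-injective L xs≡ys))
  ... | inj₂ (k , neq , gk) = power-meets c k (g-sep neq gk qab)

weaken : ∀ {d T n N} {c : Code d T n} {P Q : Fin d → Fin d → Set} → (∀ {a b} → Q a b → P a b) → Labelling c N P → Labelling c N Q
weaken Q⊆P (f , f-sep) = f , λ x≢y eq → f-sep x≢y eq ∘ Q⊆P

-- The invariant of the induction on the list of pairs. `joint` serves the pairs treated so far,
-- while `single` keeps a labelling ready for whichever pair comes next, both with the same N.
record Stage (d T n N : ℕ) (es : List (Fin d × Fin d)) : Set where
  field
    code   : Code d T n
    single : ∀ e → Labelling code N (λ a b → (a , b) ≡ e)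
    joint  : Labelling code N (λ a b → (a , b) ∈ es)

stage-suc : ∀ {d T n N es} .{{_ : NonZero N}} L e → Stage d T n N es → Stage d (T ^ L) (L * n) (N ^ suc L) (e ∷ es)
stage-suc L e st = record
  { code   = power code L
  -- A labelling chained with itself, so that `single` and `joint` again have the same number of
  -- labels.
  ; single = λ e → weaken inj₁ (chain code L (single e) (single e))
  ; joint  = weaken (λ { (here eq) → inj₁ eq ; (there e∈) → inj₂ e∈ }) (chain code L (single e) joint)
  }
  where open Stage st

recast : ∀ {d T T′ n n′ N N′ es} → T ≡ T′ → n ≡ n′ → N ≡ N′ → Stage d T n N es → Stage d T′ n′ N′ es
recast refl refl refl st = st

-- Each pair multiplies the exponent of T by L and that of N by L + 1; for large L the two exponents
-- stay close.
stages : ∀ {d T n N} .{{_ : NonZero N}} L es → Stage d T n N [] →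
  Stage d (T ^ (L ^ length es)) (L ^ length es * n) (N ^ (suc L ^ length es)) es
stages {n = n} L [] = recast (sym (ℕ.*-identityʳ _)) (sym (ℕ.+-identityʳ n)) (sym (ℕ.*-identityʳ _))
stages {n = n} {N} L (e ∷ es) st =
  recast (exp _ L) (sym (ℕ.*-assoc L (L ^ m) n)) (exp N (suc L))
    (stage-suc {{ℕ.m^n≢0 N (suc L ^ m)}} L e (stages L es st))
  where
  m = length es
  exp : ∀ T L → (T ^ (L ^ m)) ^ L ≡ T ^ (L * L ^ m)
  exp T L = trans (ℕ.^-*-assoc T (L ^ m) L) (cong (T ^_) (ℕ.*-comm (L ^ m) L))

-- Fibres and images of maps on finite sets.

Unique⇒lookup-injective : ∀ {A : Set} {xs : List A} → Unique xs → Injective _≡_ _≡_ (List.lookup xs)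
Unique⇒lookup-injective (x∉ ∷ u) {zero}  {zero}  eq = refl
Unique⇒lookup-injective (x∉ ∷ u) {zero}  {suc j} eq = ⊥-elim (All.lookup x∉ (∈-lookup j) eq)
Unique⇒lookup-injective (x∉ ∷ u) {suc i} {zero}  eq = ⊥-elim (All.lookup x∉ (∈-lookup i) (sym eq))
Unique⇒lookup-injective (x∉ ∷ u) {suc i} {suc j} eq = cong suc (Unique⇒lookup-injective u eq)

module _ {T N : ℕ} (f : Fin T → Fin N) where

  fibre : Fin N → List (Fin T)
  fibre l = filter (λ x → f x ≟ l) (allFin T)

  ∈-fibre : ∀ x → x ∈ fibre (f x)
  ∈-fibre x = ∈-filter⁺ (λ y → f y ≟ f x) (∈-allFin x) refl

  -- An element is determined by its label together with its position in the fibre of that label.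
  size≤bound*fibres : ∀ R → (∀ l → length (fibre l) ≤ R) → T ≤ R * N
  size≤bound*fibres R length≤ = Fin.injective⇒≤ ψ-injective
    where
    ψ : Fin T → Fin (R * N)
    ψ x = combine (inject≤ (index (∈-fibre x)) (length≤ (f x))) (f x)
    -- The labels are generalised to variables l and l′, because an equality `f x ≡ f y` cannot be
    -- matched with `refl`.
    same : ∀ {l l′ x y} → l ≡ l′ → (x∈ : x ∈ fibre l) (y∈ : y ∈ fibre l′) →
      inject≤ (index x∈) (length≤ l) ≡ inject≤ (index y∈) (length≤ l′) → x ≡ y
    same {l} refl x∈ y∈ eq = index-injective (setoid _) x∈ y∈ (Fin.inject≤-injective (length≤ l) (length≤ l) _ _ eq)
    ψ-injective : Injective _≡_ _≡_ ψ
    ψ-injective {x} {y} eq =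
      let eq₁ , eq₂ = Fin.combine-injective _ (f x) _ (f y) eq in same eq₂ (∈-fibre x) (∈-fibre y) eq₁

  -- If every fibre had fewer than R elements, `size≤bound*fibres` would give T ≤ (R - 1) * N < R *
  -- N.
  pigeonhole-fibre : ∀ {R} .{{_ : NonZero N}} → R * N ≤ T →
    ∃ λ (φ : Fin R → Fin T) → Injective _≡_ _≡_ φ × ∀ i j → f (φ i) ≡ f (φ j)
  pigeonhole-fibre {zero}  le = (λ ()) , (λ { {()} }) , λ ()
  pigeonhole-fibre {suc R} le with Fin.any? (λ l → suc R ≤? length (fibre l))
  ... | no small = ⊥-elim (ℕ.<⇒≱ (ℕ.≤-trans (ℕ.+-monoˡ-≤ (R * N) (>-nonZero⁻¹ N)) le)
                     (size≤bound*fibres R (λ l → ℕ.≤-pred (ℕ.≰⇒> (λ big → small (l , big))))))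
  ... | yes (l , big) = φ , φ-injective , λ i j → trans (f∘φ i) (sym (f∘φ j))
    where
    φ : Fin (suc R) → Fin T
    φ i = List.lookup (fibre l) (inject≤ i big)
    φ-injective : Injective _≡_ _≡_ φ
    φ-injective eq = Fin.inject≤-injective big big _ _ (Unique⇒lookup-injective (Unique.filter⁺ (λ x → f x ≟ l) (Unique.allFin⁺ T)) eq)
    f∘φ : ∀ i → f (φ i) ≡ l
    f∘φ i = proj₂ (∈-filter⁻ (λ x → f x ≟ l) {xs = allFin T} (∈-lookup (inject≤ i big)))

-- The fields `label` and `label-f` say that `size` labels suffice to tell the values of `f` apart;
-- `pick` and `f-pick` give `size` representatives with distinct values, from which `size` is
-- bounded above.
record Image {T : ℕ} {B : Set} (f : Fin T → B) : Set where
  field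
    size     : ℕ
    label    : Fin T → Fin size
    pick     : Fin size → Fin T
    label-f  : ∀ {x y} → label x ≡ label y → f x ≡ f y
    f-pick   : ∀ {k l} → f (pick k) ≡ f (pick l) → k ≡ l

image : ∀ {T} {B : Set} → DecidableEquality B → (f : Fin T → B) → Image f
image {T} _≟_ f = record
  { size = length ys
  ; label = index ∘ in-ys
  ; pick = λ k → proj₁ (hit k)
  ; label-f = λ {x} {y} eq → index-injective (setoid _) (in-ys x) (in-ys y) eq
  ; f-pick = λ {k} {l} eq → Unique⇒lookup-injective (deduplicate-! _≟_ (List.tabulate f)) (trans (proj₂ (hit k)) (trans eq (sym (proj₂ (hit l)))))
  }
  where
  ys = deduplicate _≟_ (List.tabulate f)
  in-ys : ∀ x → f x ∈ ys
  in-ys x = ∈-deduplicate⁺ _≟_ (∈-tabulate⁺ x)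
  hit : ∀ k → ∃ λ x → List.lookup ys k ≡ f x
  hit k = ∈-tabulate⁻ (∈-deduplicate⁻ _≟_ (List.tabulate f) (∈-lookup k))

-- Arrangements of two symbols and the central binomial coefficient.

occ : ∀ {d n} → Fin d → Vec (Fin d) n → ℕ
occ a = count (a ≟_)

-- The Boolean words with k times `true` and l times `false`, listed along Pascal's recursion.
arrangements : ℕ → ℕ → List (List Bool)
arrangements zero    l       = replicate l false ∷ []
arrangements (suc k) zero    = replicate (suc k) true ∷ []
arrangements (suc k) (suc l) = map (true ∷_) (arrangements k (suc l)) ++ map (false ∷_) (arrangements (suc k) l)

arrangements-unique : ∀ k l → Unique (arrangements k l)
arrangements-unique zero    l       = All.[] ∷ []
arrangements-unique (suc k) zero    = All.[] ∷ []
arrangements-unique (suc k) (suc l) = Unique.++⁺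
  (Unique.map⁺ List.∷-injectiveʳ (arrangements-unique k (suc l)))
  (Unique.map⁺ List.∷-injectiveʳ (arrangements-unique (suc k) l)) disjoint
  where
  disjoint : Disjoint (map (true ∷_) (arrangements k (suc l))) (map (false ∷_) (arrangements (suc k) l))
  disjoint (v∈₁ , v∈₂) with ∈-map⁻ (true ∷_) v∈₁ | ∈-map⁻ (false ∷_) v∈₂
  ... | _ , _ , refl | _ , _ , ()

trues falses : List Bool → ℕ
trues []           = 0
trues (true ∷ u)   = suc (trues u)
trues (false ∷ u)  = trues u
falses []          = 0
falses (true ∷ u)  = falses u
falses (false ∷ u) = suc (falses u)

length-trues+falses : ∀ u → length u ≡ trues u + falses u
length-trues+falses []          = refl
length-trues+falses (true ∷ u)  = cong suc (length-trues+falses u)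
length-trues+falses (false ∷ u) = trans (cong suc (length-trues+falses u)) (sym (ℕ.+-suc (trues u) (falses u)))

arrangements-counts : ∀ k l {u} → u ∈ arrangements k l → trues u ≡ k × falses u ≡ l
arrangements-counts zero    l       (here refl) = none l , all l
  where
  none : ∀ l → trues (replicate l false) ≡ 0
  none zero    = refl
  none (suc l) = none l
  all : ∀ l → falses (replicate l false) ≡ l
  all zero    = refl
  all (suc l) = cong suc (all l)
arrangements-counts (suc k) zero    (here refl) = cong suc (all k) , none k
  where
  none : ∀ k → falses (replicate k true) ≡ 0
  none zero    = refl
  none (suc k) = none k
  all : ∀ k → trues (replicate k true) ≡ k
  all zero    = refl
  all (suc k) = cong suc (all k)
arrangements-counts (suc k) (suc l) u∈ with ∈-++⁻ (map (true ∷_) (arrangements k (suc l))) u∈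
... | inj₁ u∈₁ with ∈-map⁻ (true ∷_) u∈₁
...   | v , v∈ , refl = let eq₁ , eq₂ = arrangements-counts k (suc l) v∈ in cong suc eq₁ , eq₂
arrangements-counts (suc k) (suc l) u∈ | inj₂ u∈₂ with ∈-map⁻ (false ∷_) u∈₂
...   | v , v∈ , refl = let eq₁ , eq₂ = arrangements-counts (suc k) l v∈ in eq₁ , cong suc eq₂

-- The length is the binomial coefficient (k + l choose k), written without division; Pascal's rule
-- becomes the splitting of the factor `suc k + suc l`.
length-arrangements : ∀ k l → k ! * l ! * length (arrangements k l) ≡ (k + l) !
length-arrangements zero    l    = trans (ℕ.*-identityʳ _) (ℕ.*-identityˡ _)
length-arrangements (suc k) zero = trans (ℕ.*-identityʳ _) (trans (ℕ.*-identityʳ _) (cong _! (sym (ℕ.+-identityʳ (suc k)))))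
length-arrangements (suc k) (suc l) = begin
  suc k ! * suc l ! * length (arrangements (suc k) (suc l))
    ≡⟨ cong (suc k ! * suc l ! *_) (trans (List.length-++ (map (true ∷_) (arrangements k (suc l))))
         (cong₂ _+_ (List.length-map (true ∷_) (arrangements k (suc l))) (List.length-map (false ∷_) (arrangements (suc k) l)))) ⟩
  suc k ! * suc l ! * (A + B)
    ≡⟨ split k l (k !) (l !) A B ⟩
  suc k * (k ! * suc l ! * A) + suc l * (suc k ! * l ! * B)
    ≡⟨ cong₂ (λ x y → suc k * x + suc l * y) (length-arrangements k (suc l)) (length-arrangements (suc k) l) ⟩
  suc k * (k + suc l) ! + suc l * (suc k + l) !
    ≡⟨ cong (λ m → suc k * (k + suc l) ! + suc l * m !) (sym (ℕ.+-suc k l)) ⟩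
  suc k * (k + suc l) ! + suc l * (k + suc l) !
    ≡⟨ ℕ.*-distribʳ-+ ((k + suc l) !) (suc k) (suc l) ⟨
  (suc k + suc l) ! ∎
  where
  open ≡-Reasoning
  A = length (arrangements k (suc l))
  B = length (arrangements (suc k) l)
  split : ∀ k l x y A B → suc k * x * (suc l * y) * (A + B) ≡ suc k * (x * (suc l * y) * A) + suc l * (suc k * x * y * B)
  split = solve-∀

-- After multiplication by `s ! * s !` the right side is (2s + 1)!. The step from s to s + 1
-- multiplies the left side by (2s + 2)² and the right side by (2s + 2)(2s + 3).
central-lower : ∀ s → 4 ^ s ≤ suc (s + s) * length (arrangements s s)
central-lower s = ℕ.*-cancelˡ-≤ (s ! * s !) {{ℕ.m*n≢0 (s !) (s !) {{s !≢0}} {{s !≢0}}}} (begin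
  s ! * s ! * 4 ^ s                                  ≤⟨ go s ⟩
  suc (s + s) * (s + s) !                            ≡⟨ cong (suc (s + s) *_) (length-arrangements s s) ⟨
  suc (s + s) * (s ! * s ! * length (arrangements s s)) ≡⟨ rearrange (suc (s + s)) (s ! * s !) _ ⟩
  s ! * s ! * (suc (s + s) * length (arrangements s s)) ∎)
  where
  open ℕ.≤-Reasoning
  rearrange : ∀ a b c → a * (b * c) ≡ b * (a * c)
  rearrange = solve-∀
  go : ∀ s → s ! * s ! * 4 ^ s ≤ suc (s + s) * (s + s) !
  go zero    = ℕ.≤-refl
  go (suc s) = begin
    suc s ! * suc s ! * 4 ^ suc s                                ≡⟨ e₁ s (s !) (4 ^ s) ⟩
    2 * suc s * (2 * suc s) * (s ! * s ! * 4 ^ s)                ≤⟨ ℕ.*-mono-≤ (ℕ.*-monoˡ-≤ (2 * suc s) (ℕ.n≤1+n (2 * suc s))) (go s) ⟩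
    suc (2 * suc s) * (2 * suc s) * (suc (s + s) * (s + s) !)    ≡⟨ e₂ s ((s + s) !) ⟩
    suc (suc s + suc s) * (suc (suc (s + s)) * (suc (s + s) * (s + s) !)) ≡⟨ cong (λ m → suc (suc s + suc s) * (suc m !)) (ℕ.+-suc s s) ⟨
    suc (suc s + suc s) * (suc s + suc s) !                      ∎
    where
    e₁ : ∀ s x y → suc s * x * (suc s * x) * (4 * y) ≡ 2 * suc s * (2 * suc s) * (x * x * y)
    e₁ = solve-∀
    e₂ : ∀ s x → suc (2 * suc s) * (2 * suc s) * (suc (s + s) * x) ≡ suc (suc s + suc s) * (suc (suc (s + s)) * (suc (s + s) * x))
    e₂ = solve-∀

-- Classes of words under replacing b by a.

module _ {d : ℕ} {a b : Fin d} (a≢b : a ≢ b) where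

  mask : ∀ {n} → Vec (Fin d) n → List Bool
  mask []       = []
  mask (x ∷ xs) with a ≟ x | b ≟ x
  ... | yes _ | _     = true ∷ mask xs
  ... | no _  | yes _ = false ∷ mask xs
  ... | no _  | no _  = mask xs

  merge : ∀ {n} → Vec (Fin d) n → Vec (Fin d) n
  merge []       = []
  merge (x ∷ xs) with b ≟ x
  ... | yes _ = a ∷ merge xs
  ... | no _  = x ∷ merge xs

  -- Moves inside the class of a word: the merge stays and the mask becomes u. So the masks count
  -- the members of a class.
  refill : ∀ {n} → Vec (Fin d) n → List Bool → Vec (Fin d) n
  refill []       u = []
  refill (x ∷ xs) u with a ≟ x | b ≟ x
  refill (x ∷ xs) u           | no _  | no _  = x ∷ refill xs u
  -- A default for u shorter than the mask, chosen so that the merge still does not change.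
  refill (x ∷ xs) []          | _     | _     = x ∷ xs
  refill (x ∷ xs) (true ∷ u)  | _     | _     = a ∷ refill xs u
  refill (x ∷ xs) (false ∷ u) | _     | _     = b ∷ refill xs u

  occ-a≡trues : ∀ {n} (xs : Vec (Fin d) n) → occ a xs ≡ trues (mask xs)
  occ-a≡trues []       = refl
  occ-a≡trues (x ∷ xs) with a ≟ x | b ≟ x
  ... | yes _ | _     = cong suc (occ-a≡trues xs)
  ... | no _  | yes _ = occ-a≡trues xs
  ... | no _  | no _  = occ-a≡trues xs

  occ-b≡falses : ∀ {n} (xs : Vec (Fin d) n) → occ b xs ≡ falses (mask xs)
  occ-b≡falses []       = refl
  occ-b≡falses (x ∷ xs) with a ≟ x | b ≟ x
  ... | yes refl | yes refl = ⊥-elim (a≢b refl)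
  ... | yes _    | no _     = occ-b≡falses xs
  ... | no _     | yes _    = cong suc (occ-b≡falses xs)
  ... | no _     | no _     = occ-b≡falses xs

  occ-merge : ∀ {n c} → c ≢ a → c ≢ b → (xs : Vec (Fin d) n) → occ c (merge xs) ≡ occ c xs
  occ-merge c≢a c≢b []       = refl
  occ-merge {c = c} c≢a c≢b (x ∷ xs) with b ≟ x
  ... | yes refl with c ≟ a | c ≟ b
  ...   | yes c≡a | _       = ⊥-elim (c≢a c≡a)
  ...   | no _    | yes c≡b = ⊥-elim (c≢b c≡b)
  ...   | no _    | no _    = occ-merge c≢a c≢b xs
  occ-merge {c = c} c≢a c≢b (x ∷ xs) | no _ with c ≟ x
  ...   | yes _ = cong suc (occ-merge c≢a c≢b xs)
  ...   | no _  = occ-merge c≢a c≢b xs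

  mask-a : ∀ {n} (xs : Vec (Fin d) n) → mask (a ∷ xs) ≡ true ∷ mask xs
  mask-a xs with a ≟ a
  ... | yes _  = refl
  ... | no a≢a = ⊥-elim (a≢a refl)

  mask-b : ∀ {n} (xs : Vec (Fin d) n) → mask (b ∷ xs) ≡ false ∷ mask xs
  mask-b xs with a ≟ b | b ≟ b
  ... | yes a≡b | _      = ⊥-elim (a≢b a≡b)
  ... | no _    | yes _  = refl
  ... | no _    | no b≢b = ⊥-elim (b≢b refl)

  merge-a : ∀ {n} (xs : Vec (Fin d) n) → merge (a ∷ xs) ≡ a ∷ merge xs
  merge-a xs with b ≟ a
  ... | yes _ = refl
  ... | no _  = refl

  merge-b : ∀ {n} (xs : Vec (Fin d) n) → merge (b ∷ xs) ≡ a ∷ merge xs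
  merge-b xs with b ≟ b
  ... | yes _  = refl
  ... | no b≢b = ⊥-elim (b≢b refl)

  mask-refill : ∀ {n} (xs : Vec (Fin d) n) u → length u ≡ length (mask xs) → mask (refill xs u) ≡ u
  mask-refill []       []      eq = refl
  mask-refill (x ∷ xs) u       eq with a ≟ x in a≟x | b ≟ x in b≟x
  mask-refill (x ∷ xs) (true ∷ u)  eq | yes _ | _     = trans (mask-a _) (cong (true ∷_) (mask-refill xs u (ℕ.suc-injective eq)))
  mask-refill (x ∷ xs) (false ∷ u) eq | yes _ | _     = trans (mask-b _) (cong (false ∷_) (mask-refill xs u (ℕ.suc-injective eq)))
  mask-refill (x ∷ xs) (true ∷ u)  eq | no _  | yes _ = trans (mask-a _) (cong (true ∷_) (mask-refill xs u (ℕ.suc-injective eq)))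
  mask-refill (x ∷ xs) (false ∷ u) eq | no _  | yes _ = trans (mask-b _) (cong (false ∷_) (mask-refill xs u (ℕ.suc-injective eq)))
  mask-refill (x ∷ xs) u           eq | no _  | no _ rewrite a≟x | b≟x = mask-refill xs u eq

  merge-refill : ∀ {n} (xs : Vec (Fin d) n) u → merge (refill xs u) ≡ merge xs
  merge-refill []       u = refl
  merge-refill (x ∷ xs) u with a ≟ x | b ≟ x in b≟x
  merge-refill (x ∷ xs) u           | no _     | no _ rewrite b≟x = cong (x ∷_) (merge-refill xs u)
  merge-refill (x ∷ xs) []          | yes _    | yes _ rewrite b≟x = refl
  merge-refill (x ∷ xs) []          | yes _    | no _  rewrite b≟x = refl
  merge-refill (x ∷ xs) []          | no _     | yes _ rewrite b≟x = refl
  merge-refill (x ∷ xs) (true ∷ u)  | yes _    | yes _ = trans (merge-a _) (cong (a ∷_) (merge-refill xs u))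
  merge-refill (x ∷ xs) (true ∷ u)  | yes refl | no _  = trans (merge-a _) (cong (a ∷_) (merge-refill xs u))
  merge-refill (x ∷ xs) (true ∷ u)  | no _     | yes _ = trans (merge-a _) (cong (a ∷_) (merge-refill xs u))
  merge-refill (x ∷ xs) (false ∷ u) | yes _    | yes _ = trans (merge-b _) (cong (a ∷_) (merge-refill xs u))
  merge-refill (x ∷ xs) (false ∷ u) | yes refl | no _  = trans (merge-b _) (cong (a ∷_) (merge-refill xs u))
  merge-refill (x ∷ xs) (false ∷ u) | no _     | yes _ = trans (merge-b _) (cong (a ∷_) (merge-refill xs u))

  refill-length : ∀ {n s} (xs : Vec (Fin d) n) {u} → (∀ c → occ c xs ≡ s) → u ∈ arrangements s s →
    length u ≡ length (mask xs)
  refill-length {s = s} xs {u} uniform u∈ = begin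
    length u                              ≡⟨ length-trues+falses u ⟩
    trues u + falses u                    ≡⟨ cong₂ _+_ (proj₁ (arrangements-counts s s u∈)) (proj₂ (arrangements-counts s s u∈)) ⟩
    s + s                                 ≡⟨ cong₂ _+_ (trans (sym (occ-a≡trues xs)) (uniform a)) (trans (sym (occ-b≡falses xs)) (uniform b)) ⟨
    trues (mask xs) + falses (mask xs)    ≡⟨ length-trues+falses (mask xs) ⟨
    length (mask xs)                      ∎
    where open ≡-Reasoning

  occ-b∷<a∷ : ∀ {n} (xs ys : Vec (Fin d) n) → occ a xs ≤ occ a ys → occ a (b ∷ xs) < occ a (a ∷ ys)
  occ-b∷<a∷ xs ys le with a ≟ b | a ≟ a
  ... | yes a≡b | _      = ⊥-elim (a≢b a≡b)
  ... | no _    | yes _  = s≤s le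
  ... | no _    | no a≢a = ⊥-elim (a≢a refl)

  -- Where x and y differ, they carry {a, b}; if a never sits above b, then x has fewer a's than y.
  merge-≡⇒meet : ∀ {n} (xs ys : Vec (Fin d) n) → merge xs ≡ merge ys →
    (∃ λ p → lookup xs p ≡ a × lookup ys p ≡ b) ⊎ xs ≡ ys ⊎ occ a xs < occ a ys
  merge-≡⇒meet []       []       eq = inj₂ (inj₁ refl)
  merge-≡⇒meet (x ∷ xs) (y ∷ ys) eq with merge-≡⇒meet xs ys (tails eq) | heads eq
    where
    tails : merge (x ∷ xs) ≡ merge (y ∷ ys) → merge xs ≡ merge ys
    tails eq with b ≟ x | b ≟ y
    ... | yes _ | yes _ = Vec.∷-injectiveʳ eq
    ... | yes _ | no _  = Vec.∷-injectiveʳ eq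
    ... | no _  | yes _ = Vec.∷-injectiveʳ eq
    ... | no _  | no _  = Vec.∷-injectiveʳ eq
    heads : merge (x ∷ xs) ≡ merge (y ∷ ys) → (x ≡ a × y ≡ b) ⊎ (x ≡ b × y ≡ a) ⊎ x ≡ y
    heads eq with b ≟ x | b ≟ y
    ... | yes b≡x | yes b≡y = inj₂ (inj₂ (trans (sym b≡x) b≡y))
    ... | yes b≡x | no _    = inj₂ (inj₁ (sym b≡x , sym (Vec.∷-injectiveˡ eq)))
    ... | no _    | yes b≡y = inj₁ (Vec.∷-injectiveˡ eq , sym b≡y)
    ... | no _    | no _    = inj₂ (inj₂ (Vec.∷-injectiveˡ eq))
  ... | inj₁ (p , r)     | _                        = inj₁ (suc p , r)
  ... | _                | inj₁ r                   = inj₁ (zero , r)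
  ... | inj₂ (inj₁ refl) | inj₂ (inj₂ refl)         = inj₂ (inj₁ refl)
  ... | inj₂ (inj₁ refl) | inj₂ (inj₁ (refl , refl)) = inj₂ (inj₂ (occ-b∷<a∷ xs xs ℕ.≤-refl))
  ... | inj₂ (inj₂ lt)   | inj₂ (inj₁ (refl , refl)) = inj₂ (inj₂ (occ-b∷<a∷ xs ys (ℕ.<⇒≤ lt)))
  ... | inj₂ (inj₂ lt)   | inj₂ (inj₂ refl) with a ≟ x
  ...   | yes _ = inj₂ (inj₂ (s≤s lt))
  ...   | no _  = inj₂ (inj₂ lt)

  -- The counts of a and b are read off the new mask u, those of all other symbols off the unchanged
  -- merge.
  refill-occ : ∀ {n s} (xs : Vec (Fin d) n) {u} → (∀ c → occ c xs ≡ s) → u ∈ arrangements s s →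
    ∀ c → occ c (refill xs u) ≡ s
  refill-occ {s = s} xs {u} uniform u∈ c = by-cases (c ≟ a) (c ≟ b)
    where
    open ≡-Reasoning
    mask≡ : mask (refill xs u) ≡ u
    mask≡ = mask-refill xs u (refill-length xs uniform u∈)
    by-cases : Dec (c ≡ a) → Dec (c ≡ b) → occ c (refill xs u) ≡ s
    by-cases (yes refl) _ = trans (occ-a≡trues (refill xs u)) (trans (cong trues mask≡) (proj₁ (arrangements-counts s s u∈)))
    by-cases (no _) (yes refl) = trans (occ-b≡falses (refill xs u)) (trans (cong falses mask≡) (proj₂ (arrangements-counts s s u∈)))
    by-cases (no c≢a) (no c≢b) = begin
      occ c (refill xs u)         ≡⟨ occ-merge c≢a c≢b (refill xs u) ⟨
      occ c (merge (refill xs u)) ≡⟨ cong (occ c) (merge-refill xs u) ⟩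
      occ c (merge xs)            ≡⟨ occ-merge c≢a c≢b xs ⟩
      occ c xs                    ≡⟨ uniform c ⟩
      s                           ∎

-- The base code: words using every symbol s times.

occ-++ : ∀ {d m n} (c : Fin d) (xs : Vec (Fin d) m) (ys : Vec (Fin d) n) → occ c (xs Vec.++ ys) ≡ occ c xs + occ c ys
occ-++ c []       ys = refl
occ-++ c (x ∷ xs) ys with c ≟ x
... | yes _ = cong suc (occ-++ c xs ys)
... | no _  = occ-++ c xs ys

occ-tabulate-∉ : ∀ {d n} (c : Fin d) (f : Fin n → Fin d) → (∀ i → c ≢ f i) → occ c (Vec.tabulate f) ≡ 0
occ-tabulate-∉ {n = zero}  c f c∉ = refl
occ-tabulate-∉ {n = suc n} c f c∉ with c ≟ f zero
... | yes c≡ = ⊥-elim (c∉ zero c≡)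
... | no _   = occ-tabulate-∉ c (f ∘ suc) (c∉ ∘ suc)

occ-tabulate : ∀ {d n} (f : Fin n → Fin d) → Injective _≡_ _≡_ f → ∀ i → occ (f i) (Vec.tabulate f) ≡ 1
occ-tabulate f inj zero with f zero ≟ f zero
... | yes _  = cong suc (occ-tabulate-∉ (f zero) (f ∘ suc) (λ _ → Fin.0≢1+n ∘ inj))
... | no neq = ⊥-elim (neq refl)
occ-tabulate f inj (suc i) with f (suc i) ≟ f zero
... | yes eq = ⊥-elim (Fin.0≢1+n (sym (inj eq)))
... | no _   = occ-tabulate (f ∘ suc) (Fin.suc-injective ∘ inj) i

module Uniform (d s : ℕ) where

  IsUniform : Vec (Fin d) (s * d) → Set
  IsUniform xs = ∀ c → occ c xs ≡ s

  isUniform? : ∀ xs → Dec (IsUniform xs)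
  isUniform? xs = Fin.all? (λ c → occ c xs ℕ.≟ s)

  words : List (Vec (Fin d) (s * d))
  words = filter isUniform? (map (decode (s * d)) (List.allFin (d ^ (s * d))))

  words-unique : Unique words
  words-unique = Unique.filter⁺ isUniform? (Unique.map⁺ (decode-injective (s * d)) (Unique.allFin⁺ _))

  ∈-words : ∀ {xs} → IsUniform xs → xs ∈ words
  ∈-words {xs} u = ∈-filter⁺ isUniform? (subst (_∈ map (decode (s * d)) (List.allFin _)) (decode-encode xs) (∈-map⁺ _ (∈-allFin (encode xs)))) u

  T : ℕ
  T = length words

  word : Fin T → Vec (Fin d) (s * d)
  word = List.lookup words

  word-uniform : ∀ i → IsUniform (word i)
  word-uniform i = proj₂ (∈-filter⁻ isUniform? {xs = map (decode (s * d)) (List.allFin _)} (∈-lookup i))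

  M : ℕ
  M = length (arrangements s s)

  -- All symbols in order, repeated s times. It shows that there is a class at all, hence that `N`
  -- is not zero.
  some-word : Fin T
  some-word = index (∈-words {Vec.concat (Vec.replicate s (Vec.allFin d))} (go s))
    where
    go : ∀ s c → occ c (Vec.concat (Vec.replicate s (Vec.allFin d))) ≡ s
    go zero    c = refl
    go (suc s) c = trans (occ-++ c (Vec.allFin d) _) (cong₂ _+_ (occ-tabulate id id c) (go s c))

  -- The prefix listing all symbols makes any two words show the pairs (a , a). Its d positions are
  -- negligible against `s * d` for large s.
  code : Code d T (d + s * d)
  code i p = [ id , lookup (word i) ]′ (splitAt d p)

  code-prefix : ∀ i a → code i (a ↑ˡ (s * d)) ≡ a
  code-prefix i a = cong [ id , lookup (word i) ]′ (Fin.splitAt-↑ˡ d a (s * d))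

  code-word : ∀ i p → code i (d ↑ʳ p) ≡ lookup (word i) p
  code-word i p = cong [ id , lookup (word i) ]′ (Fin.splitAt-↑ʳ d (s * d) p)

  module _ {a b : Fin d} (a≢b : a ≢ b) where

    merged : Image (merge a≢b ∘ word)
    merged = image (Vec.≡-dec _≟_) (merge a≢b ∘ word)

    open Image merged

    -- One representative of each class, refilled with each of the `M` masks, gives distinct words:
    -- the merge recovers the class and the mask recovers the filling.
    size*M≤T : size * M ≤ T
    size*M≤T = Fin.injective⇒≤ {f = φ} φ-injective
      where
      u : Fin M → List Bool
      u = List.lookup (arrangements s s)
      refilled : Fin size → Fin M → Vec (Fin d) (s * d)
      refilled k j = refill a≢b (word (pick k)) (u j)
      refilled∈ : ∀ k j → refilled k j ∈ words
      refilled∈ k j = ∈-words (refill-occ a≢b (word (pick k)) (word-uniform (pick k)) (∈-lookup j))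
      φ : Fin (size * M) → Fin T
      φ i = let k , j = remQuot {size} M i in index (refilled∈ k j)
      refilled-injective : ∀ {k j k′ j′} → refilled k j ≡ refilled k′ j′ → k ≡ k′ × j ≡ j′
      refilled-injective {k} {j} {k′} {j′} eq = f-pick (trans (sym (merge-refill a≢b (word (pick k)) (u j))) (trans (cong (merge a≢b) eq) (merge-refill a≢b (word (pick k′)) (u j′)))) ,
        Unique⇒lookup-injective (arrangements-unique s s) (trans (sym (mask-refilled k j)) (trans (cong (mask a≢b) eq) (mask-refilled k′ j′)))
        where
        mask-refilled : ∀ k j → mask a≢b (refilled k j) ≡ u j
        mask-refilled k j = mask-refill a≢b (word (pick k)) (u j) (refill-length a≢b (word (pick k)) (word-uniform (pick k)) (∈-lookup j))
      φ-injective : Injective _≡_ _≡_ φ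
      φ-injective {i} {i′} eq =
        let k , j = remQuot {size} M i
            k′ , j′ = remQuot {size} M i′
            k≡ , j≡ = refilled-injective (index-injective (setoid _) (refilled∈ k j) (refilled∈ k′ j′) eq)
        in trans (sym (Fin.combine-remQuot {size} M i)) (trans (cong₂ combine k≡ j≡) (Fin.combine-remQuot {size} M i′))

    label-separating : Separating code (λ a′ b′ → (a′ , b′) ≡ (a , b)) label
    label-separating {x} {y} x≢y eq refl with merge-≡⇒meet a≢b (word x) (word y) (label-f eq)
    ... | inj₁ (p , xp≡a , yp≡b) = d ↑ʳ p , trans (code-word x p) xp≡a , trans (code-word y p) yp≡b
    ... | inj₂ (inj₁ eq′)        = ⊥-elim (x≢y (Unique⇒lookup-injective words-unique eq′))
    -- Uniform words contain a equally often.
    ... | inj₂ (inj₂ lt)         = ⊥-elim (ℕ.<-irrefl (trans (word-uniform x a) (sym (word-uniform y a))) lt)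

  instance
    M≢0 : NonZero M
    M≢0 = >-nonZero (ℕ.n≢0⇒n>0 λ M≡0 → ℕ.<⇒≱ (ℕ.m^n>0 4 s) (ℕ.≤-trans (central-lower s) (ℕ.≤-reflexive (trans (cong (suc (s + s) *_) M≡0) (ℕ.*-zeroʳ (suc (s + s)))))))

  -- A common bound on the number of classes for all pairs a ≠ b. Later estimates use `T` only
  -- through `N * M ≤ T`, so the multinomial coefficient `T` is never evaluated.
  N : ℕ
  N = T ℕ./ M

  size≤N : ∀ {a b} (a≢b : a ≢ b) → Image.size (merged a≢b) ≤ N
  size≤N a≢b = ℕ.≤-trans (ℕ.≤-reflexive (sym (m*n/n≡m _ M))) (/-monoˡ-≤ M (size*M≤T a≢b))

  N≢0 : 2 ≤ d → NonZero N
  N≢0 (s≤s (s≤s _)) = >-nonZero (ℕ.<-≤-trans (ℕ.≤-<-trans z≤n (Fin.toℕ<n (Image.label (merged 0≢1) some-word))) (size≤N 0≢1))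
    where
    0≢1 : zero ≢ suc zero
    0≢1 ()

  stage : 2 ≤ d → Stage d T (d + s * d) N []
  stage 2≤d = record
    { code   = code
    ; single = single
    -- No pair has been treated yet, so the choice of the labelling is arbitrary.
    ; joint  = weaken (λ ()) (single (zero₀ 2≤d , zero₀ 2≤d))
    }
    where
    instance _ = N≢0 2≤d
    zero₀ : 2 ≤ d → Fin d
    zero₀ (s≤s _) = zero
    single : ∀ e → Labelling code N (λ a b → (a , b) ≡ e)
    single (a , b) with a ≟ b
    -- All words may share one label, since the prefix shows (a , a).
    ... | yes refl = (λ _ → 0 mod N) , λ { {x} {y} _ _ refl → a ↑ˡ (s * d) , code-prefix x a , code-prefix y a }
    ... | no a≢b   = (λ x → inject≤ (Image.label (merged a≢b) x) (size≤N a≢b)) ,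
      λ x≢y eq → label-separating a≢b x≢y (Fin.inject≤-injective (size≤N a≢b) (size≤N a≢b) _ _ eq)

-- Choice of the parameters and the rate of the resulting code.

n<2^n : ∀ n → n < 2 ^ n
n<2^n zero    = s≤s z≤n
n<2^n (suc n) = ℕ.≤-trans (ℕ.+-mono-≤ (ℕ.m^n>0 2 n) (n<2^n n)) (ℕ.≤-reflexive (cong (2 ^ n +_) (sym (ℕ.+-identityʳ _))))

-- Bernoulli's inequality (1 - 1/(L+1))^m ≥ 1 - m/(L+1), cleared of denominators.
bernoulli : ∀ L m → suc L ^ m * suc L ≤ L ^ m * suc L + m * suc L ^ m
bernoulli L zero    = ℕ.m≤m+n _ _
bernoulli L (suc m) = begin
  suc L * suc L ^ m * suc L                                  ≡⟨ ℕ.*-assoc (suc L) (suc L ^ m) (suc L) ⟩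
  suc L * (suc L ^ m * suc L)                                ≤⟨ ℕ.*-monoʳ-≤ (suc L) (bernoulli L m) ⟩
  suc L * (L ^ m * suc L + m * suc L ^ m)                    ≡⟨ e L m (L ^ m) (suc L ^ m) ⟩
  L * L ^ m * suc L + (suc L * L ^ m + m * (suc L * suc L ^ m)) ≤⟨ ℕ.+-monoʳ-≤ (L * L ^ m * suc L) (ℕ.+-monoˡ-≤ _ (ℕ.*-monoʳ-≤ (suc L) (ℕ.^-monoˡ-≤ m (ℕ.n≤1+n L)))) ⟩
  L * L ^ m * suc L + suc m * (suc L * suc L ^ m)            ∎
  where
  open ℕ.≤-Reasoning
  e : ∀ L m x y → suc L * (x * suc L + m * y) ≡ L * x * suc L + (suc L * x + m * (suc L * y))
  e = solve-∀

-- Bernoulli's inequality with `suc L = suc m * suc K`: the power of L / (L + 1) is at least 1 - 1 /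
-- (K + 1) = K / (K + 1).
power-ratio : ∀ m K → ∃ λ L → K * suc L ^ suc m ≤ suc K * L ^ suc m × K ≤ L
power-ratio m K = L , ℕ.+-cancelˡ-≤ (suc L ^ suc m) _ _ (ℕ.*-cancelʳ-≤ _ _ (suc m) (begin
    (suc L ^ suc m + K * suc L ^ suc m) * suc m     ≡⟨ e₁ (suc L ^ suc m) K (suc m) ⟩
    suc L ^ suc m * (suc m * suc K)                 ≤⟨ bernoulli L (suc m) ⟩
    L ^ suc m * (suc m * suc K) + suc m * suc L ^ suc m ≡⟨ e₂ (L ^ suc m) (suc L ^ suc m) (suc m) (suc K) ⟩
    (suc L ^ suc m + suc K * L ^ suc m) * suc m     ∎)) , ℕ.m≤m+n K (m * suc K)
  where
  open ℕ.≤-Reasoning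
  L = K + m * suc K
  e₁ : ∀ y K m → (y + K * y) * m ≡ y * (m * suc K)
  e₁ = solve-∀
  e₂ : ∀ x y m K → x * (m * K) + m * y ≡ (y + K * x) * m
  e₂ = solve-∀

^-distribʳ-* : ∀ k m n → (m * n) ^ k ≡ m ^ k * n ^ k
^-distribʳ-* zero    m n = refl
^-distribʳ-* (suc k) m n = trans (cong (m * n *_) (^-distribʳ-* k m n)) (e m n (m ^ k) (n ^ k))
  where
  e : ∀ m n x y → m * n * (x * y) ≡ m * x * (n * y)
  e = solve-∀

-- From `N * M ≤ T` the quotient of `T ^ A` by `N ^ A` is at least 2 ^ (suc ρ * A). The surplus
-- `N ^ (B ∸ A)` is at most `2 ^ A`, because N < 2 ^ N and `N * (B ∸ A) ≤ A`; it uses up the extra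
-- one in `suc ρ`.
fibre-size : ∀ {T N M} ρ A B → N * M ≤ T → 2 ^ suc ρ ≤ M → A ≤ B → N * B ≤ suc N * A → 2 ^ (ρ * A) * N ^ B ≤ T ^ A
fibre-size {T} {N} {M} ρ A B NM≤T 2^ρ≤M A≤B NB≤ = begin
  2 ^ (ρ * A) * N ^ B                 ≡⟨ cong (λ m → 2 ^ (ρ * A) * N ^ m) (ℕ.m+[n∸m]≡n A≤B) ⟨
  2 ^ (ρ * A) * N ^ (A + D)           ≡⟨ cong (2 ^ (ρ * A) *_) (ℕ.^-distribˡ-+-* N A D) ⟩
  2 ^ (ρ * A) * (N ^ A * N ^ D)       ≤⟨ ℕ.*-monoʳ-≤ (2 ^ (ρ * A)) (ℕ.*-monoʳ-≤ (N ^ A) N^D≤2^A) ⟩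
  2 ^ (ρ * A) * (N ^ A * 2 ^ A)       ≡⟨ e (2 ^ (ρ * A)) (N ^ A) (2 ^ A) ⟩
  N ^ A * (2 ^ A * 2 ^ (ρ * A))       ≡⟨ cong (N ^ A *_) (ℕ.^-distribˡ-+-* 2 A (ρ * A)) ⟨
  N ^ A * 2 ^ (suc ρ * A)             ≡⟨ cong (N ^ A *_) (ℕ.^-*-assoc 2 (suc ρ) A) ⟨
  N ^ A * (2 ^ suc ρ) ^ A             ≤⟨ ℕ.*-monoʳ-≤ (N ^ A) (ℕ.^-monoˡ-≤ A 2^ρ≤M) ⟩
  N ^ A * M ^ A                       ≡⟨ ^-distribʳ-* A N M ⟨
  (N * M) ^ A                         ≤⟨ ℕ.^-monoˡ-≤ A NM≤T ⟩
  T ^ A                               ∎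
  where
  open ℕ.≤-Reasoning
  D = B ∸ A
  e : ∀ x y z → x * (y * z) ≡ y * (z * x)
  e = solve-∀
  ND≤A : N * D ≤ A
  ND≤A = ℕ.+-cancelˡ-≤ (N * A) _ _ (begin
    N * A + N * D   ≡⟨ ℕ.*-distribˡ-+ N A D ⟨
    N * (A + D)     ≡⟨ cong (N *_) (ℕ.m+[n∸m]≡n A≤B) ⟩
    N * B           ≤⟨ NB≤ ⟩
    A + N * A       ≡⟨ ℕ.+-comm A (N * A) ⟩
    N * A + A       ∎)
  N^D≤2^A : N ^ D ≤ 2 ^ A
  N^D≤2^A = begin
    N ^ D           ≤⟨ ℕ.^-monoˡ-≤ D (ℕ.<⇒≤ (n<2^n N)) ⟩
    (2 ^ N) ^ D     ≡⟨ ℕ.^-*-assoc 2 N D ⟩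
    2 ^ (N * D)     ≤⟨ ℕ.^-monoʳ-≤ 2 ND≤A ⟩
    2 ^ A           ∎

-- Makes the loss j + 5 small against 2 ^ (j + 1). With j = 2 * i, one factor 2 ^ i dominates
-- `suc q` and the other, doubled, dominates j + 5.
exponent : ∀ q → ∃ λ j → suc q * (j + 5) ≤ 2 ^ suc j
exponent q = i + i , (begin
    suc q * (i + i + 5)           ≤⟨ ℕ.*-mono-≤ (ℕ.≤-trans (s≤s (ℕ.m≤n+m q 2)) (ℕ.<⇒≤ (n<2^n i))) le ⟩
    2 ^ i * (2 * 2 ^ i)           ≡⟨ e (2 ^ i) ⟩
    2 * (2 ^ i * 2 ^ i)           ≡⟨ cong (2 *_) (ℕ.^-distribˡ-+-* 2 i i) ⟨
    2 ^ suc (i + i)               ∎)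
  where
  open ℕ.≤-Reasoning
  i = 3 + q
  e : ∀ x → x * (2 * x) ≡ 2 * (x * x)
  e = solve-∀
  e₁ : ∀ q → 3 + q + (3 + q) + 5 + 5 + 14 * q ≡ 2 * (2 * (2 * (2 * suc q)))
  e₁ = solve-∀
  le : i + i + 5 ≤ 2 * 2 ^ i
  le = begin
    i + i + 5                     ≤⟨ ℕ.≤-trans (ℕ.m≤m+n _ 5) (ℕ.m≤m+n _ (14 * q)) ⟩
    i + i + 5 + 5 + 14 * q        ≡⟨ e₁ q ⟩
    2 * (2 * (2 * (2 * suc q)))   ≤⟨ ℕ.*-monoʳ-≤ 2 (ℕ.*-monoʳ-≤ 2 (ℕ.*-monoʳ-≤ 2 (ℕ.*-monoʳ-≤ 2 (n<2^n q)))) ⟩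
    2 * 2 ^ i                     ∎

-- For s = 2 ^ j the factor `suc (s + s)` of `central-lower` is at most 4 * s = 2 ^ (2 + j), which
-- leaves the exponent 2 * s - (j + 2) = `suc ρ`.
central-exponent : ∀ j ρ → ρ + (j + 3) ≡ 2 ^ suc j → 2 ^ suc ρ ≤ length (arrangements (2 ^ j) (2 ^ j))
central-exponent j ρ eq = ℕ.*-cancelˡ-≤ (2 ^ (2 + j)) {{ℕ.m^n≢0 2 (2 + j)}} (begin
  2 ^ (2 + j) * 2 ^ suc ρ          ≡⟨ ℕ.^-distribˡ-+-* 2 (2 + j) (suc ρ) ⟨
  2 ^ (2 + j + suc ρ)              ≡⟨ cong (2 ^_) (trans (e j ρ) eq) ⟩
  2 ^ (2 * s)                      ≡⟨ ℕ.^-*-assoc 2 2 s ⟨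
  4 ^ s                            ≤⟨ central-lower s ⟩
  suc (s + s) * M                  ≤⟨ ℕ.*-monoˡ-≤ M (ℕ.≤-trans (ℕ.+-monoˡ-≤ (s + s) (ℕ.≤-trans (ℕ.m^n>0 2 j) (ℕ.m≤m+n s s))) (ℕ.≤-reflexive (e′ s))) ⟩
  2 ^ (2 + j) * M                  ∎)
  where
  open ℕ.≤-Reasoning
  s = 2 ^ j
  M = length (arrangements s s)
  e : ∀ j ρ → 2 + j + suc ρ ≡ ρ + (j + 3)
  e = solve-∀
  e′ : ∀ s → s + s + (s + s) ≡ 2 * (2 * s)
  e′ = solve-∀

-- The rate r / n approaches 2 / d.
good-code : ∀ d → 2 ≤ d → ∀ q → 1 ≤ q → ∃₂ λ n r → 1 ≤ r × 2 * n * q ≤ d * suc q * r × ∃ λ (c : Code d (2 ^ r) n) → FullySeparating c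
good-code d@(suc d-1) 2≤d q 1≤q = A * (d + s * d) , ρ * A , 1≤r , rate , code , separating
  where
  open ℕ.≤-Reasoning
  j = proj₁ (exponent q)
  s = 2 ^ j
  -- Here 2 ^ suc j = 2 * s is the binary logarithm of 4 ^ s. From it j + 2 is paid for
  -- `suc (s + s)` in `central-lower` and 1 for the surplus in `fibre-size`.
  ρ = 2 ^ suc j ∸ (j + 3)
  j-large = proj₂ (exponent q)
  ρ-eq : ρ + (j + 3) ≡ 2 ^ suc j
  ρ-eq = ℕ.m∸n+n≡m (ℕ.≤-trans (ℕ.≤-trans (ℕ.+-monoʳ-≤ j (s≤s (s≤s (s≤s z≤n)))) (ℕ.m≤m+n (j + 5) (q * (j + 5)))) j-large)
  open Uniform d s using (T; N; M; N≢0; M≢0) renaming (stage to base)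
  instance _ = N≢0 2≤d
  pairs = cartesianProduct (List.allFin d) (List.allFin d)
  -- As d is a successor, length pairs reduces to suc m.
  m = pred (length pairs)
  -- With K = `N` the exponents satisfy `N * B ≤ suc N * A`, as `fibre-size` requires.
  ratio = power-ratio m N
  L = proj₁ ratio
  A = L ^ suc m
  B = suc L ^ suc m
  A≥1 : 1 ≤ A
  A≥1 = ℕ.m^n>0 L {{>-nonZero (ℕ.≤-trans (>-nonZero⁻¹ N) (proj₂ (proj₂ ratio)))}} (suc m)
  open Stage (stages L pairs (base 2≤d)) using (joint) renaming (code to full)
  -- A single label class of the last stage; on it the labelling for all d * d pairs is constant.
  hole = pigeonhole-fibre (proj₁ joint) {2 ^ (ρ * A)} {{ℕ.m^n≢0 N B}}
    (fibre-size ρ A B (m/n*n≤m T M) (central-exponent j ρ ρ-eq) (ℕ.^-monoˡ-≤ (suc m) (ℕ.n≤1+n L)) (proj₁ (proj₂ ratio)))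
  code : Code d (2 ^ (ρ * A)) (A * (d + s * d))
  code = full ∘ proj₁ hole
  separating : FullySeparating code
  separating _ _ x≢y a b = proj₂ joint (x≢y ∘ proj₁ (proj₂ hole)) (proj₂ (proj₂ hole) _ _) (∈-cartesianProduct⁺ (∈-allFin a) (∈-allFin b))
  -- Since 2 * s = ρ + (j + 3), this is the claim on the rate after cancelling common factors and q
  -- * ρ.
  ρ-large : 2 * q + q * (j + 3) ≤ ρ
  ρ-large = ℕ.+-cancelʳ-≤ (j + 3) _ _ (begin
    2 * q + q * (j + 3) + (j + 3)     ≤⟨ ℕ.m≤n+m _ 2 ⟩
    2 + (2 * q + q * (j + 3) + (j + 3)) ≡⟨ e q j ⟩
    suc q * (j + 5)                   ≤⟨ j-large ⟩
    2 ^ suc j                         ≡⟨ ρ-eq ⟨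
    ρ + (j + 3)                       ∎)
    where
    e : ∀ q j → 2 + (2 * q + q * (j + 3) + (j + 3)) ≡ suc q * (j + 5)
    e = solve-∀
  1≤r : 1 ≤ ρ * A
  1≤r = ℕ.*-mono-≤ (ℕ.≤-trans (ℕ.≤-trans (ℕ.≤-trans 1≤q (ℕ.m≤m+n q (q + 0))) (ℕ.m≤m+n (2 * q) _)) ρ-large) A≥1
  rate : 2 * (A * (d + s * d)) * q ≤ d * suc q * (ρ * A)
  rate = begin
    2 * (A * (d + s * d)) * q              ≡⟨ e₁ A d s q ⟩
    A * d * (2 * q + q * (2 * s))          ≡⟨ cong (λ x → A * d * (2 * q + q * x)) ρ-eq ⟨
    A * d * (2 * q + q * (ρ + (j + 3)))    ≡⟨ cong (A * d *_) (e₂ q ρ j) ⟩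
    A * d * (2 * q + q * (j + 3) + q * ρ)  ≤⟨ ℕ.*-monoʳ-≤ (A * d) (ℕ.+-monoˡ-≤ (q * ρ) ρ-large) ⟩
    A * d * (suc q * ρ)                    ≡⟨ e₃ A d (suc q) ρ ⟩
    d * suc q * (ρ * A)                    ∎
    where
    e₁ : ∀ A d s q → 2 * (A * (d + s * d)) * q ≡ A * d * (2 * q + q * (2 * s))
    e₁ = solve-∀
    e₂ : ∀ q ρ j → 2 * q + q * (ρ + (j + 3)) ≡ 2 * q + q * (j + 3) + q * ρ
    e₂ = solve-∀
    e₃ : ∀ A d q ρ → A * d * (q * ρ) ≡ d * q * (ρ * A)
    e₃ = solve-∀

-- Finite sums and cardinalities.

⟦_⟧ : Bool → ℕ
⟦ true ⟧  = 1
⟦ false ⟧ = 0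

∣∣≡∑ : ∀ {n} (S : Subset n) → ∣ S ∣ ≡ ∑ (λ i → ⟦ lookup S i ⟧)
∣∣≡∑ []          = refl
∣∣≡∑ (true ∷ S)  = cong suc (∣∣≡∑ S)
∣∣≡∑ (false ∷ S) = ∣∣≡∑ S

∑-mono : ∀ {n} {f g : Fin n → ℕ} → (∀ i → f i ≤ g i) → ∑ f ≤ ∑ g
∑-mono {zero}  le = z≤n
∑-mono {suc n} le = ℕ.+-mono-≤ (le zero) (∑-mono (le ∘ suc))

∑-const : ∀ n c → ∑ {n} (λ _ → c) ≡ n * c
∑-const zero    c = refl
∑-const (suc n) c = cong (c +_) (∑-const n c)

∑-+ : ∀ m {n} (f : Fin (m + n) → ℕ) → ∑ f ≡ ∑ (λ i → f (i ↑ˡ n)) + ∑ (λ j → f (m ↑ʳ j))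
∑-+ zero    f = refl
∑-+ (suc m) f = trans (cong (f zero +_) (∑-+ m (f ∘ suc))) (sym (ℕ.+-assoc (f zero) _ _))

∑-* : ∀ m {n} (f : Fin (m * n) → ℕ) → ∑ f ≡ ∑ (λ i → ∑ (λ j → f (combine {m} {n} i j)))
∑-* zero        f = refl
∑-* (suc m) {n} f = trans (∑-+ n f) (cong (∑ (λ j → f (j ↑ˡ (m * n))) +_) (∑-* m (λ v → f (n ↑ʳ v))))

∑-indicator : ∀ {n} (i : Fin n) → ∑ (λ j → ⟦ does (i ≟ j) ⟧) ≡ 1
∑-indicator {suc n} zero    = cong suc (sum-replicate-zero n)
∑-indicator {suc n} (suc i) = ∑-indicator i

quotient-combine : ∀ {m n} (i : Fin m) (j : Fin n) → quotient n (combine i j) ≡ i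
quotient-combine i j = cong proj₁ (Fin.remQuot-combine i j)

-- From codes to clique coverings.

module _ {d t n : ℕ} (c : Code d t n) where

  -- Symbol p of word i names the one vertex chosen in part i. Position p shows (a , b) in two words
  -- exactly when this clique contains vertex a of the first part and vertex b of the second.
  clique : Fin n → Subset (t * d)
  clique p = Vec.tabulate (λ v → does (c (quotient d v) p ≟ remainder {t} d v))

  ∈-clique⁺ : ∀ {p v} → c (quotient d v) p ≡ remainder {t} d v → v Subset.∈ clique p
  ∈-clique⁺ {p} {v} eq = Vec.lookup⇒[]= v (clique p) (trans (Vec.lookup∘tabulate _ v) (dec-true (_ ≟ _) eq))

  ∈-clique⁻ : ∀ {p v} → v Subset.∈ clique p → c (quotient d v) p ≡ remainder {t} d v
  ∈-clique⁻ {p} {v} v∈ with c (quotient d v) p ≟ remainder {t} d v | trans (sym (Vec.lookup∘tabulate _ v)) (Vec.[]=⇒lookup v∈)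
  ... | yes eq | _ = eq

  clique-isClique : ∀ p → IsClique (K t d) (clique p)
  clique-isClique p v w v∈ w∈ v≢w q≡ = v≢w (begin
    v                                                       ≡⟨ Fin.combine-remQuot {t} d v ⟨
    combine (quotient {t} d v) (remainder {t} d v)          ≡⟨ cong₂ combine q≡ (trans (sym (∈-clique⁻ v∈)) (trans (cong (λ i → c i p) q≡) (∈-clique⁻ w∈))) ⟩
    combine (quotient {t} d w) (remainder {t} d w)          ≡⟨ Fin.combine-remQuot {t} d w ⟩
    w                                                       ∎)
    where open ≡-Reasoning

  ∣clique∣ : ∀ p → ∣ clique p ∣ ≡ t
  ∣clique∣ p = begin
    ∣ clique p ∣                                                    ≡⟨ ∣∣≡∑ (clique p) ⟩
    ∑ (λ v → ⟦ lookup (clique p) v ⟧)                               ≡⟨ ∑-* t _ ⟩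
    ∑ (λ i → ∑ (λ a → ⟦ lookup (clique p) (combine {t} {d} i a) ⟧)) ≡⟨ sum-cong-≗ (λ i → trans (sum-cong-≗ (entry i)) (∑-indicator (c i p))) ⟩
    ∑ {t} (λ _ → 1)                                                 ≡⟨ trans (∑-const t 1) (ℕ.*-identityʳ t) ⟩
    t                                                               ∎
    where
    open ≡-Reasoning
    entry : ∀ i a → ⟦ lookup (clique p) (combine {t} {d} i a) ⟧ ≡ ⟦ does (c i p ≟ a) ⟧
    entry i a = cong ⟦_⟧ (trans (Vec.lookup∘tabulate _ (combine {t} {d} i a))
      (cong (λ (j , b) → does (c j p ≟ b)) (Fin.remQuot-combine {t} {d} i a)))

  -- Different positions may yield the same clique, hence `deduplicate`, which can only lower the
  -- weight.
  covering : FullySeparating c → CliqueCovering (K t d)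
  covering separating = record
    { cliques    = cliques
    ; unique     = deduplicate-! _≟ₛ_ (List.tabulate clique)
    ; areCliques = All.tabulate (λ S∈ → let p , eq = ∈-tabulate⁻ (∈-deduplicate⁻ _≟ₛ_ (List.tabulate clique) S∈) in subst (IsClique (K t d)) (sym eq) (clique-isClique p))
    ; covers     = λ v w q≢ → let p , eq₁ , eq₂ = separating _ _ q≢ (remainder {t} d v) (remainder {t} d w) in
        lose (∈-deduplicate⁺ _≟ₛ_ (∈-tabulate⁺ p)) (∈-clique⁺ eq₁ , ∈-clique⁺ eq₂)
    }
    where
    _≟ₛ_ = Vec.≡-dec Bool._≟_
    cliques = deduplicate _≟ₛ_ (List.tabulate clique)

  covering-weight : (sep : FullySeparating c) → CliqueCovering.weight (covering sep) ≤ n * t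
  covering-weight sep = ℕ.≤-trans (bound _ (λ S∈ → let p , eq = ∈-tabulate⁻ (∈-deduplicate⁻ _≟ₛ_ (List.tabulate clique) S∈) in ℕ.≤-reflexive (trans (cong ∣_∣ eq) (∣clique∣ p))))
    (ℕ.*-monoˡ-≤ t (ℕ.≤-trans (List.length-deduplicate _≟ₛ_ (List.tabulate clique)) (ℕ.≤-reflexive (List.length-tabulate clique))))
    where
    _≟ₛ_ = Vec.≡-dec Bool._≟_
    bound : ∀ (Ss : List (Subset (t * d))) → (∀ {S} → S ∈ Ss → ∣ S ∣ ≤ t) → sum (map ∣_∣ Ss) ≤ length Ss * t
    bound []       le = z≤n
    bound (S ∷ Ss) le = ℕ.+-mono-≤ (le (Any.here refl)) (bound Ss (le ∘ Any.there))

scc-minimal : ∀ {n} (G : Graph n) (C : CliqueCovering G) → scc G ≤ CliqueCovering.weight C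
scc-minimal G C = proj₂ (proj₂ (scc-exists G)) _ (C , refl)

-- Take t of the 2 ^ (r * k) words of the k-th power, which have length k * n; every position
-- contributes a clique of size t.
scc-upper : ∀ {d n r} (c : Code d (2 ^ r) n) → FullySeparating c → ∀ t k → t ≤ 2 ^ (r * k) → scc (K t d) ≤ k * n * t
scc-upper {d} {n} {r} c sep t k t≤ = ℕ.≤-trans (scc-minimal (K t d) (covering c′ sep′)) (covering-weight c′ sep′)
  where
  t≤′ : t ≤ (2 ^ r) ^ k
  t≤′ = ℕ.≤-trans t≤ (ℕ.≤-reflexive (sym (ℕ.^-*-assoc 2 r k)))
  c′ : Code d t (k * n)
  c′ i = power c k (inject≤ i t≤′)
  sep′ : FullySeparating c′
  sep′ _ _ i≢j = power-separating c k sep _ _ (i≢j ∘ Fin.inject≤-injective t≤′ t≤′ _ _)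

-- Partial colourings and a Kraft inequality.

-- A pattern is a partial 2-colouring; nothing marks a free coordinate.
Pattern : ℕ → Set
Pattern n = Fin n → Maybe Bool

fixed¹ free¹ : Maybe Bool → ℕ
fixed¹ (just _) = 1
fixed¹ nothing  = 0
free¹  (just _) = 0
free¹  nothing  = 1

fixed free : ∀ {n} → Pattern n → ℕ
fixed p = ∑ (fixed¹ ∘ p)
free  p = ∑ (free¹ ∘ p)

fixed+free : ∀ {n} (p : Pattern n) → fixed p + free p ≡ n
fixed+free {n} p = trans (sym (∑-distrib-+ (fixed¹ ∘ p) (free¹ ∘ p))) (trans (sum-cong-≗ (one ∘ p)) (trans (∑-const n 1) (ℕ.*-identityʳ n)))
  where
  one : ∀ x → fixed¹ x + free¹ x ≡ 1
  one (just _) = refl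
  one nothing  = refl

Conflict : ∀ {n} → Pattern n → Pattern n → Set
Conflict p q = ∃ λ k → ∃ λ x → p k ≡ just x × q k ≡ just (not x)

allows : Bool → Maybe Bool → Bool
allows v     nothing  = true
allows true  (just x) = x
allows false (just x) = not x

-- The traces of the subcubes on the half of {0,1}ⁿ⁺¹ whose first coordinate is v.
restrict : ∀ {n} → Bool → List (Pattern (suc n)) → List (Pattern n)
restrict v []       = []
restrict v (p ∷ ps) = if allows v (p zero) then (p ∘ suc) ∷ restrict v ps else restrict v ps

-- Two patterns that both allow v cannot conflict in the first coordinate, so their conflict
-- survives its removal.
restrict-conflict : ∀ {n} v {p q : Pattern (suc n)} → allows v (p zero) ≡ true → allows v (q zero) ≡ true →
  Conflict p q → Conflict (p ∘ suc) (q ∘ suc)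
restrict-conflict v pv qv (suc k , r) = k , r
restrict-conflict v {p} {q} pv qv (zero , x , p≡ , q≡) = ⊥-elim (clash v x (subst (λ m → allows v m ≡ true) p≡ pv) (subst (λ m → allows v m ≡ true) q≡ qv))
  where
  clash : ∀ v x → allows v (just x) ≡ true → allows v (just (not x)) ≢ true
  clash true  true  _  ()
  clash true  false () _
  clash false true  () _
  clash false false _  ()

restrict-allPairs : ∀ {n} v {ps : List (Pattern (suc n))} → AllPairs Conflict ps → AllPairs Conflict (restrict v ps)
restrict-allPairs v []             = []
restrict-allPairs v {p ∷ ps} (cs ∷ conflicts) with allows v (p zero) in pv
... | false = restrict-allPairs v conflicts
... | true  = against ps cs ∷ restrict-allPairs v conflicts
  where
  against : ∀ qs → All (Conflict p) qs → All (Conflict (p ∘ suc)) (restrict v qs)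
  against []       []       = []
  against (q ∷ qs) (c ∷ cs) with allows v (q zero) in qv
  ... | false = against qs cs
  ... | true  = restrict-conflict v pv qv c ∷ against qs cs

-- The number of completions in {0,1}ⁿ, counted with multiplicity.
volume : ∀ {n} → List (Pattern n) → ℕ
volume ps = sum (map (λ p → 2 ^ free p) ps)

-- A pattern with free first coordinate has half of its completions on each side; a fixed first
-- coordinate puts all of them on one side.
volume-restrict : ∀ {n} (ps : List (Pattern (suc n))) → volume ps ≡ volume (restrict true ps) + volume (restrict false ps)
volume-restrict []       = refl
volume-restrict (p ∷ ps) with p zero | volume-restrict ps
... | nothing    | ih = trans (cong (2 * 2 ^ free (p ∘ suc) +_) ih) (e (2 ^ free (p ∘ suc)) (volume (restrict true ps)) (volume (restrict false ps)))
  where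
  e : ∀ x a b → 2 * x + (a + b) ≡ x + a + (x + b)
  e = solve-∀
... | just true  | ih = trans (cong (2 ^ free (p ∘ suc) +_) ih) (sym (ℕ.+-assoc (2 ^ free (p ∘ suc)) _ _))
... | just false | ih = trans (cong (2 ^ free (p ∘ suc) +_) ih) (e (2 ^ free (p ∘ suc)) (volume (restrict true ps)) (volume (restrict false ps)))
  where
  e : ∀ x a b → x + (a + b) ≡ a + (x + b)
  e = solve-∀

-- Conflicting patterns have no common completion, so their subcubes of {0,1}ⁿ are disjoint.
kraft : ∀ {n} (ps : List (Pattern n)) → AllPairs Conflict ps → volume ps ≤ 2 ^ n
kraft {zero}  []           _                        = z≤n
kraft {zero}  (p ∷ [])     _                        = s≤s z≤n
kraft {zero}  (p ∷ q ∷ ps) (((() , _) ∷ _) ∷ _)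
kraft {suc n} ps           conflicts                = begin
  volume ps                                               ≡⟨ volume-restrict ps ⟩
  volume (restrict true ps) + volume (restrict false ps)  ≤⟨ ℕ.+-mono-≤ (kraft _ (restrict-allPairs true conflicts)) (kraft _ (restrict-allPairs false conflicts)) ⟩
  2 ^ n + 2 ^ n                                           ≡⟨ cong (2 ^ n +_) (ℕ.+-identityʳ (2 ^ n)) ⟨
  2 ^ suc n                                               ∎
  where open ℕ.≤-Reasoning

-- Replaces a convexity argument. For each p, k is at most `fixed p` plus the truncated deficit
-- `k ∸ fixed p`, and the deficit is at most 2 ^ (k - fixed p). By `kraft` these powers add up to at
-- most 2 ^ k; multiplying by 2 ^ n keeps the exponents natural.
kraft-fixed : ∀ {n} (ps : List (Pattern n)) → AllPairs Conflict ps → ∀ k → length ps * k ≤ sum (map fixed ps) + 2 ^ k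
kraft-fixed {n} ps conflicts k = ℕ.≤-trans (split ps) (ℕ.+-monoʳ-≤ (sum (map fixed ps))
  (ℕ.*-cancelˡ-≤ (2 ^ n) {{ℕ.m^n≢0 2 n}} (ℕ.≤-trans (deficits ps) (ℕ.≤-trans (ℕ.*-monoʳ-≤ (2 ^ k) (kraft ps conflicts)) (ℕ.≤-reflexive (ℕ.*-comm (2 ^ k) (2 ^ n)))))))
  where
  open ℕ.≤-Reasoning
  deficit : Pattern n → ℕ
  deficit p = k ∸ fixed p
  split : ∀ ps → length ps * k ≤ sum (map fixed ps) + sum (map deficit ps)
  split []       = z≤n
  split (p ∷ ps) = ℕ.≤-trans (ℕ.+-mono-≤ (ℕ.m≤n+m∸n k (fixed p)) (split ps)) (ℕ.≤-reflexive (e (fixed p) (deficit p) _ _))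
    where
    e : ∀ a b c d → a + b + (c + d) ≡ a + c + (b + d)
    e = solve-∀
  deficit≤ : ∀ p → 2 ^ n * deficit p ≤ 2 ^ k * 2 ^ free p
  deficit≤ p with ℕ.≤-total k (fixed p)
  ... | inj₁ k≤ = ℕ.≤-trans (ℕ.≤-reflexive (trans (cong (2 ^ n *_) (ℕ.m≤n⇒m∸n≡0 k≤)) (ℕ.*-zeroʳ (2 ^ n)))) z≤n
  ... | inj₂ k≥ = begin
    2 ^ n * deficit p                                ≤⟨ ℕ.*-monoʳ-≤ (2 ^ n) (ℕ.<⇒≤ (n<2^n (deficit p))) ⟩
    2 ^ n * 2 ^ deficit p                            ≡⟨ ℕ.^-distribˡ-+-* 2 n (deficit p) ⟨
    2 ^ (n + deficit p)                              ≡⟨ cong (λ m → 2 ^ (m + deficit p)) (fixed+free p) ⟨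
    2 ^ (fixed p + free p + deficit p)               ≡⟨ cong (2 ^_) (e (fixed p) (free p) (deficit p)) ⟩
    2 ^ (fixed p + deficit p + free p)               ≡⟨ cong (λ m → 2 ^ (m + free p)) (ℕ.m+[n∸m]≡n k≥) ⟩
    2 ^ (k + free p)                                 ≡⟨ ℕ.^-distribˡ-+-* 2 k (free p) ⟩
    2 ^ k * 2 ^ free p                               ∎
    where
    e : ∀ a b c → a + b + c ≡ a + c + b
    e = solve-∀
  deficits : ∀ ps → 2 ^ n * sum (map deficit ps) ≤ 2 ^ k * volume ps
  deficits []       = ℕ.≤-reflexive (trans (ℕ.*-zeroʳ (2 ^ n)) (sym (ℕ.*-zeroʳ (2 ^ k))))
  deficits (p ∷ ps) = begin
    2 ^ n * (deficit p + sum (map deficit ps))               ≡⟨ ℕ.*-distribˡ-+ (2 ^ n) (deficit p) _ ⟩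
    2 ^ n * deficit p + 2 ^ n * sum (map deficit ps)         ≤⟨ ℕ.+-mono-≤ (deficit≤ p) (deficits ps) ⟩
    2 ^ k * 2 ^ free p + 2 ^ k * volume ps                   ≡⟨ ℕ.*-distribˡ-+ (2 ^ k) (2 ^ free p) _ ⟨
    2 ^ k * (2 ^ free p + volume ps)                         ∎

-- The lower bound: degrees of the vertices in a covering.

sum-tabulate : ∀ {n} (f : Fin n → ℕ) → sum (List.tabulate f) ≡ ∑ f
sum-tabulate {zero}  f = refl
sum-tabulate {suc n} f = cong (f zero +_) (sum-tabulate (f ∘ suc))

sum-map-lookup : ∀ {A : Set} (f : A → ℕ) (xs : List A) → sum (map f xs) ≡ ∑ (f ∘ List.lookup xs)
sum-map-lookup f []       = refl
sum-map-lookup f (x ∷ xs) = cong (f x +_) (sum-map-lookup f xs)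

-- Adds the bound over the edges of the cycle 0, 1, ..., `suc e`, 0, which meets every index twice.
-- For e = 0 the two edges are the same pair.
∑-pairs : ∀ {e} (D : Fin (2 + e) → ℕ) Q → (∀ a b → a ≢ b → Q ≤ D a + D b) → (2 + e) * Q ≤ 2 * ∑ D
∑-pairs {e} D Q pair = begin
  Q + suc e * Q                                                            ≡⟨ cong (Q +_) (∑-const (suc e) Q) ⟨
  Q + ∑ {suc e} (λ _ → Q)                                                  ≤⟨ ℕ.+-mono-≤ (pair zero (fromℕ (suc e)) (λ ())) (∑-mono (λ a → pair (inject₁ a) (suc a) (inject₁≢suc a))) ⟩
  D zero + D (fromℕ (suc e)) + ∑ (λ a → D (inject₁ a) + D (suc a))         ≡⟨ cong (D zero + D (fromℕ (suc e)) +_) (∑-distrib-+ (D ∘ inject₁) (D ∘ suc)) ⟩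
  D zero + D (fromℕ (suc e)) + (∑ (D ∘ inject₁) + ∑ (D ∘ suc))             ≡⟨ r (D zero) (D (fromℕ (suc e))) (∑ (D ∘ inject₁)) (∑ (D ∘ suc)) ⟩
  ∑ (D ∘ inject₁) + D (fromℕ (suc e)) + (D zero + ∑ (D ∘ suc) + 0)         ≡⟨ cong (_+ (∑ D + 0)) (sum-init-last D) ⟨
  2 * ∑ D                                                                  ∎
  where
  open ℕ.≤-Reasoning
  r : ∀ z l i s → z + l + (i + s) ≡ i + l + (z + s + 0)
  r = solve-∀
  inject₁≢suc : ∀ {n} (a : Fin n) → inject₁ a ≢ suc a
  inject₁≢suc zero    ()
  inject₁≢suc (suc a) eq = inject₁≢suc a (Fin.suc-injective eq)

module _ {t d : ℕ} (C : CliqueCovering (K t d)) where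
  open CliqueCovering C

  has : Fin (t * d) → Fin (length cliques) → Bool
  has v k = lookup (List.lookup cliques k) v

  deg : Fin (t * d) → ℕ
  deg v = ∑ (λ k → ⟦ has v k ⟧)

  total-deg : Fin d → ℕ
  total-deg a = ∑ (λ i → deg (combine {t} {d} i a))

  -- Double counting of the incidences of vertices and cliques, with the vertices then grouped by
  -- symbol.
  weight≡∑deg : weight ≡ ∑ total-deg
  weight≡∑deg = begin
    weight                                             ≡⟨ sum-map-lookup ∣_∣ cliques ⟩
    ∑ (λ k → ∣ List.lookup cliques k ∣)                ≡⟨ sum-cong-≗ (λ k → ∣∣≡∑ (List.lookup cliques k)) ⟩
    ∑ (λ k → ∑ (λ v → ⟦ has v k ⟧))                    ≡⟨ ∑-comm (λ k v → ⟦ has v k ⟧) ⟩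
    ∑ deg                                              ≡⟨ ∑-* t deg ⟩
    ∑ (λ i → ∑ (λ a → deg (combine {t} {d} i a)))      ≡⟨ ∑-comm (λ i a → deg (combine {t} {d} i a)) ⟩
    ∑ total-deg                                        ∎
    where open ≡-Reasoning

  has-both⇒≡ : ∀ k v w → quotient {t} d v ≡ quotient {t} d w → has v k ≡ true → has w k ≡ true → v ≡ w
  has-both⇒≡ k v w q≡ hv hw with v Fin.≟ w
  ... | yes v≡w = v≡w
  ... | no v≢w  = ⊥-elim (All.lookup areCliques (∈-lookup k) v w (Vec.lookup⇒[]= v _ hv) (Vec.lookup⇒[]= w _ hw) v≢w q≡)

  has-common : ∀ v w → quotient {t} d v ≢ quotient {t} d w → ∃ λ k → has v k ≡ true × has w k ≡ true
  has-common v w q≢ = let c = covers v w q≢ ; v∈ , w∈ = lookup-index c in index c , Vec.[]=⇒lookup v∈ , Vec.[]=⇒lookup w∈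

  module _ {a b : Fin d} (a≢b : a ≢ b) where

    -- Two `true` arguments never occur, by `exclusive`; the value there is a default.
    mark : Bool → Bool → Maybe Bool
    mark true  _     = just true
    mark false true  = just false
    mark false false = nothing

    -- The subcube attached to part i: its coordinates are the cliques, `true` on those through
    -- vertex a and `false` on those through vertex b.
    pattern-of : Fin t → Pattern (length cliques)
    pattern-of i k = mark (has (combine i a) k) (has (combine i b) k)

    exclusive : ∀ i k → has (combine i a) k ≡ true → has (combine i b) k ≡ true → ⊥
    exclusive i k ha hb = a≢b (Fin.combine-injectiveʳ i a i b
      (has-both⇒≡ k _ _ (trans (quotient-combine i a) (sym (quotient-combine i b))) ha hb))

    -- Some clique covers the edge from vertex a of part i to vertex b of part j. Part i marks it
    -- `true`; it contains no second vertex of part j, so part j marks it `false`.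
    conflict : ∀ {i j} → i ≢ j → Conflict (pattern-of i) (pattern-of j)
    conflict {i} {j} i≢j with has-common (combine i a) (combine j b)
        (λ eq → i≢j (trans (sym (quotient-combine i a)) (trans eq (quotient-combine j b))))
    ... | k , ha , hb = k , true , cong (λ x → mark x (has (combine i b) k)) ha , at-j
      where
      at-j : pattern-of j k ≡ just false
      at-j with has (combine j a) k in ja
      ... | true  = ⊥-elim (exclusive j k ja hb)
      ... | false = cong (mark false) hb

    fixed-pattern : ∀ i → fixed (pattern-of i) ≡ deg (combine i a) + deg (combine i b)
    fixed-pattern i = trans (sum-cong-≗ entry) (∑-distrib-+ (λ k → ⟦ has (combine i a) k ⟧) (λ k → ⟦ has (combine i b) k ⟧))
      where
      entry : ∀ k → fixed¹ (pattern-of i k) ≡ ⟦ has (combine i a) k ⟧ + ⟦ has (combine i b) k ⟧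
      entry k with has (combine i a) k in ha | has (combine i b) k in hb
      ... | true  | true  = ⊥-elim (exclusive i k ha hb)
      ... | true  | false = refl
      ... | false | true  = refl
      ... | false | false = refl

    degree-lower : ∀ k → t * k ≤ total-deg a + total-deg b + 2 ^ k
    degree-lower k = begin
      t * k                                               ≡⟨ cong (_* k) (List.length-tabulate pattern-of) ⟨
      length (List.tabulate pattern-of) * k               ≤⟨ kraft-fixed (List.tabulate pattern-of) (AllPairs.tabulate⁺ conflict) k ⟩
      sum (map fixed (List.tabulate pattern-of)) + 2 ^ k  ≡⟨ cong (λ xs → sum xs + 2 ^ k) (List.map-tabulate pattern-of fixed) ⟩
      sum (List.tabulate (fixed ∘ pattern-of)) + 2 ^ k    ≡⟨ cong (_+ 2 ^ k) (sum-tabulate (fixed ∘ pattern-of)) ⟩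
      ∑ (fixed ∘ pattern-of) + 2 ^ k                      ≡⟨ cong (_+ 2 ^ k) (trans (sum-cong-≗ fixed-pattern) (∑-distrib-+ (λ i → deg (combine {t} {d} i a)) (λ i → deg (combine {t} {d} i b)))) ⟩
      total-deg a + total-deg b + 2 ^ k ∎
      where open ℕ.≤-Reasoning

-- For 2 ^ k ≤ t the error term of `degree-lower` is at most t, which turns k into `k ∸ 1`.
scc-lower : ∀ t d → 2 ≤ d → ∀ k → 2 ^ k ≤ t → d * (t * (k ∸ 1)) ≤ 2 * scc (K t d)
scc-lower t d@(suc (suc e)) (s≤s (s≤s _)) k 2^k≤t = ℕ.≤-trans
  (∑-pairs (total-deg C) (t * (k ∸ 1)) pair)
  (ℕ.≤-reflexive (cong (2 *_) (trans (sym (weight≡∑deg C)) weight≡)))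
  where
  open ℕ.≤-Reasoning
  attained = proj₁ (proj₂ (scc-exists (K t d)))
  C = proj₁ attained
  weight≡ : CliqueCovering.weight C ≡ scc (K t d)
  weight≡ = proj₂ attained
  pair : ∀ a b → a ≢ b → t * (k ∸ 1) ≤ total-deg C a + total-deg C b
  pair a b a≢b = begin
    t * (k ∸ 1)      ≡⟨ ℕ.*-distribˡ-∸ t k 1 ⟩
    t * k ∸ t * 1    ≡⟨ cong (t * k ∸_) (ℕ.*-identityʳ t) ⟩
    t * k ∸ t        ≤⟨ ℕ.m≤n+o⇒m∸n≤o (t * k) t (ℕ.≤-trans (degree-lower C a≢b k) (ℕ.≤-trans (ℕ.+-monoʳ-≤ _ 2^k≤t) (ℕ.≤-reflexive (ℕ.+-comm _ t)))) ⟩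
    _                ∎

-- Opened only here because +_ makes sections such as (2 ^ n +_) ambiguous.
open import Data.Integer using (+_; -[1+_])

-- Fractions, cuts and the limit.

floor-log₂ : ∀ t → 1 ≤ t → ∃ λ k → 2 ^ k ≤ t × t < 2 ^ suc k
floor-log₂ (suc zero)      _ = 0 , s≤s z≤n , s≤s (s≤s z≤n)
floor-log₂ (suc t@(suc _)) _ with floor-log₂ t (s≤s z≤n)
... | k , lo , hi with suc t <? 2 ^ suc k
...   | yes lt = k , ℕ.m≤n⇒m≤1+n lo , lt
...   | no  ge = suc k , ℕ.≮⇒≥ ge , ℕ.≤-<-trans hi (ℕ.^-monoʳ-< 2 (s≤s (s≤s z≤n)) (ℕ.n<1+n (suc k)))

2^-cancel-≤ : ∀ {K k} → 2 ^ K < 2 ^ suc k → K ≤ k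
2^-cancel-≤ {K} {k} lt with K ℕ.≤? k
... | yes K≤k = K≤k
... | no  K≰k = ⊥-elim (ℕ.<⇒≱ lt (ℕ.^-monoʳ-≤ 2 (ℕ.≰⇒> K≰k)))

-- The fraction a / (b + 1), since `mkℚᵘ` stores the predecessor of the denominator.
frac : ℕ → ℕ → ℚᵘ
frac a b = mkℚᵘ (+ a) b

frac-< : ∀ {a b c e} → a * suc e < c * suc b → frac a b ℚᵘ.< frac c e
frac-< {a} {b} {c} {e} lt = *<* (subst₂ ℤ._<_ (ℤ.pos-* a (suc e)) (ℤ.pos-* c (suc b)) (ℤ.+<+ lt))

frac-* : ∀ a b c e → frac a b ℚᵘ.* frac c e ≡ frac (a * c) (e + b * suc e)
frac-* a b c e = cong (λ z → mkℚᵘ z (e + b * suc e)) (sym (ℤ.pos-* a c))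

frac-+ : ∀ a b c e → frac a b ℚᵘ.+ frac c e ≡ frac (a * suc e + c * suc b) (e + b * suc e)
frac-+ a b c e = cong (λ z → mkℚᵘ z (e + b * suc e))
  (trans (cong₂ ℤ._+_ (sym (ℤ.pos-* a (suc e))) (sym (ℤ.pos-* c (suc b)))) (sym (ℤ.pos-+ (a * suc e) _)))

frac*<frac : ∀ a b c e x y → a * c * suc y < x * (suc b * suc e) → frac a b ℚᵘ.* frac c e ℚᵘ.< frac x y
frac*<frac a b c e x y lt = subst (ℚᵘ._< frac x y) (sym (frac-* a b c e)) (frac-< lt)

frac<frac* : ∀ a b c e x y → x * (suc b * suc e) < a * c * suc y → frac x y ℚᵘ.< frac a b ℚᵘ.* frac c e
frac<frac* a b c e x y lt = subst (frac x y ℚᵘ.<_) (sym (frac-* a b c e)) (frac-< lt)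

1<frac+ : ∀ a b c e → suc b * suc e < a * suc e + c * suc b → 1ℚᵘ ℚᵘ.< frac a b ℚᵘ.+ frac c e
1<frac+ a b c e lt = subst (1ℚᵘ ℚᵘ.<_) (sym (frac-+ a b c e))
  (frac-< {1} (subst₂ _<_ (sym (ℕ.*-identityˡ _)) (sym (ℕ.*-identityʳ _)) lt))

frac<1+ : ∀ a b c e → a * suc e < (suc e + c) * suc b → frac a b ℚᵘ.< 1ℚᵘ ℚᵘ.+ frac c e
frac<1+ a b c e lt = subst (frac a b ℚᵘ.<_) (sym (frac-+ 1 0 c e)) (frac-< (subst₂ _<_
  (cong (λ m → a * suc m) (sym (ℕ.+-identityʳ e)))
  (cong (_* suc b) (cong₂ _+_ (sym (ℕ.*-identityˡ (suc e))) (sym (ℕ.*-identityʳ c)))) lt))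

scale-frac : ∀ a c e → frac a 0 ℚᵘ.* frac c e ≡ frac (a * c) e
scale-frac a c e = trans (frac-* a 0 c e) (cong (frac (a * c)) (ℕ.+-identityʳ e))

p-q<r : ∀ p q r → p ℚᵘ.< r ℚᵘ.+ q → p ℚᵘ.- q ℚᵘ.< r
p-q<r p q r lt = ℚᵘ.<-respʳ-≃ (ℚᵘ.≃-trans (ℚᵘ.+-assoc r q (ℚᵘ.- q)) (ℚᵘ.≃-trans (ℚᵘ.+-congʳ r (ℚᵘ.+-inverseʳ q)) (ℚᵘ.+-identityʳ r))) (ℚᵘ.+-monoˡ-< (ℚᵘ.- q) lt)

-- Reduces a strict inequality to an identity with an explicit positive difference, which the ring
-- solver can check.
gap : ∀ {m n} c → m + suc c ≡ n → m < n
gap {m} c eq = ℕ.<-≤-trans (ℕ.m<m+n m (s≤s z≤n)) (ℕ.≤-reflexive eq)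

module Limit (d-1 t-1 : ℕ) (2≤d : 2 ≤ suc d-1) (2≤t : 2 ≤ suc t-1) where

  d = suc d-1
  t = suc t-1
  S = scc (K t d)
  quot = (+ S / 1) ÷ ½d·t·log₂ d t 2≤t [ ½d·t·log₂-pos d t 2≤d 2≤t ]

  -- Start from log₂ t < k + 1. The factor t, the factor d / 2 and the reciprocal each demand a
  -- strict inequality, and each is paid for by one more unit: k + 2, k + 3, k + 4. What remains is
  -- 1 - ε < 2 * S / (d * t * (k + 4)).
  lower-bound : ∀ e f k → t < 2 ^ suc k → d * (t * (k ∸ 1)) ≤ 2 * S → 5 * suc f ≤ k →
    ℝ.Lower quot (1ℚᵘ ℚᵘ.- frac (suc e) f)
  lower-bound e f k t< S≥ k-large =
    frac 2 (pred D) ,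
    (frac (d * (t * (3 + k))) 1 ,
      (frac (t * (2 + k)) 0 ,
        (frac (1 + k) 0 , subst (_< 2 ^ suc k) (sym (ℕ.*-identityʳ t)) t< ,
          frac*<frac t 0 (1 + k) 0 (t * (2 + k)) 0 (gap t-1 (e₁ t k)))
        , frac*<frac d 1 (t * (2 + k)) 0 (d * (t * (3 + k))) 1 (gap (pred (d * t * 2)) (e₂ d t k)))
      , frac*<frac 2 (pred D) (d * (t * (3 + k))) 1 1 0 (gap (pred (d * t * 2)) (e₃ d t k)))
    , p-q<r 1ℚᵘ (frac (suc e) f) (frac S 0 ℚᵘ.* frac 2 (pred D))
        (subst (λ x → 1ℚᵘ ℚᵘ.< x ℚᵘ.+ frac (suc e) f) (sym (scale-frac S 2 (pred D))) (1<frac+ (S * 2) (pred D) (suc e) f main))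
    where
    D = d * t * (4 + k)
    e₁ : ∀ t k → t * (1 + k) * 1 + t ≡ t * (2 + k) * (1 * 1)
    e₁ = solve-∀
    e₂ : ∀ d t k → d * (t * (2 + k)) * 2 + d * t * 2 ≡ d * (t * (3 + k)) * (2 * 1)
    e₂ = solve-∀
    e₃ : ∀ d t k → 2 * (d * (t * (3 + k))) * 1 + d * t * 2 ≡ 1 * (d * t * (4 + k) * 2)
    e₃ = solve-∀
    open ℕ.≤-Reasoning
    -- 4 + k exceeds `k ∸ 1` by at most 5, and `5 * suc f ≤ k` bounds the resulting error by D,
    -- hence by `suc e * D`.
    main : D * suc f < S * 2 * suc f + suc e * D
    main = begin-strict
      d * t * (4 + k) * suc f
        ≤⟨ ℕ.*-monoˡ-≤ (suc f) (ℕ.*-monoʳ-≤ (d * t) (ℕ.+-monoʳ-≤ 4 (ℕ.m≤n+m∸n k 1))) ⟩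
      d * t * (5 + (k ∸ 1)) * suc f
        ≡⟨ e₄ d t (k ∸ 1) (suc f) ⟩
      d * (t * (k ∸ 1)) * suc f + d * t * (5 * suc f)
        ≤⟨ ℕ.+-mono-≤ (ℕ.*-monoˡ-≤ (suc f) (ℕ.≤-trans S≥ (ℕ.≤-reflexive (ℕ.*-comm 2 S)))) (ℕ.*-monoʳ-≤ (d * t) k-large) ⟩
      S * 2 * suc f + d * t * k
        <⟨ ℕ.+-monoʳ-< (S * 2 * suc f) (ℕ.*-monoʳ-< (d * t) (ℕ.m<n+m k {4} (s≤s z≤n))) ⟩
      S * 2 * suc f + D
        ≤⟨ ℕ.+-monoʳ-≤ (S * 2 * suc f) (ℕ.m≤m+n D (e * D)) ⟩
      S * 2 * suc f + suc e * D ∎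
      where
      e₄ : ∀ d t k f → d * t * (5 + k) * f ≡ d * (t * k) * f + d * t * (5 * f)
      e₄ = solve-∀

  -- The mirror image of `lower-bound`, going down: 4 + κ < log₂ t, then 3 + κ, 2 + κ and 1 + κ
  -- after the three operations. This is why the integer part of log₂ t is written as 5 + κ.
  upper-bound : ∀ e f κ → 2 ^ (5 + κ) ≤ t → 2 * S * suc f < d * t * (1 + κ) * (2 + f) →
    ℝ.Upper quot (1ℚᵘ ℚᵘ.+ frac (suc e) f)
  upper-bound e f κ 2^k≤t S< =
    frac 2 (pred D) ,
    (frac (d * (t * (2 + κ))) 1 , frac-< (s≤s z≤n) ,
      (frac (t * (3 + κ)) 0 ,
        (frac (4 + κ) 0 , subst (2 ^ (4 + κ) <_) (sym (ℕ.*-identityʳ t))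
            (ℕ.<-≤-trans (ℕ.^-monoʳ-< 2 (s≤s (s≤s z≤n)) (ℕ.n<1+n (4 + κ))) 2^k≤t) ,
          frac<frac* t 0 (4 + κ) 0 (t * (3 + κ)) 0 (gap t-1 (e₁ t κ)))
        , frac<frac* d 1 (t * (3 + κ)) 0 (d * (t * (2 + κ))) 1 (gap (pred (d * t * 2)) (e₂ d t κ)))
      , frac<frac* 2 (pred D) (d * (t * (2 + κ))) 1 1 0 (gap (pred (d * t * 2)) (e₃ d t κ)))
    , subst (ℚᵘ._< 1ℚᵘ ℚᵘ.+ frac (suc e) f) (sym (scale-frac S 2 (pred D))) (frac<1+ (S * 2) (pred D) (suc e) f main)
    where
    D = d * t * (1 + κ)
    e₁ : ∀ t κ → t * (3 + κ) * (1 * 1) + t ≡ t * (4 + κ) * 1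
    e₁ = solve-∀
    e₂ : ∀ d t κ → d * (t * (2 + κ)) * (2 * 1) + d * t * 2 ≡ d * (t * (3 + κ)) * 2
    e₂ = solve-∀
    e₃ : ∀ d t κ → 1 * (d * t * (1 + κ) * 2) + d * t * 2 ≡ 2 * (d * (t * (2 + κ))) * 1
    e₃ = solve-∀
    open ℕ.≤-Reasoning
    main : S * 2 * suc f < (suc f + suc e) * D
    main = begin-strict
      S * 2 * suc f             ≡⟨ cong (_* suc f) (ℕ.*-comm S 2) ⟩
      2 * S * suc f             <⟨ S< ⟩
      D * (2 + f)               ≡⟨ ℕ.*-comm D (2 + f) ⟩
      (2 + f) * D               ≤⟨ ℕ.*-monoˡ-≤ D (s≤s (ℕ.m<m+n f (s≤s z≤n))) ⟩
      (suc f + suc e) * D       ∎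

-- The margin 1 / g is split into thirds: the rate of the code loses a factor 1 + 1 / (3 * g), the
-- additive constant 4 + r takes another third by the largeness of κ, and the rest leaves room for
-- strictness.
scc-numeric : ∀ {d n r g} t κ → .{{_ : NonZero d}} .{{_ : NonZero t}} .{{_ : NonZero r}} → 2 * n * (3 * g) ≤ d * suc (3 * g) * r →
  (c : Code d (2 ^ r) n) → FullySeparating c → t < 2 ^ (6 + κ) → suc (3 * g) * (4 + r) ≤ κ →
  2 * scc (K t d) * g < d * t * (1 + κ) * (1 + g)
scc-numeric {d} {n} {r} {g} t κ rate c sep t< κ-large = ℕ.*-cancelˡ-< (3 * r) _ _ (begin-strict
  3 * r * (2 * S * g)                                        ≤⟨ ℕ.*-monoʳ-≤ (3 * r) (ℕ.*-monoˡ-≤ g (ℕ.*-monoʳ-≤ 2 (scc-upper {r = r} c sep t j t≤))) ⟩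
  3 * r * (2 * (j * n * t) * g)                          ≡⟨ e₁ r j n t g ⟩
  2 * n * (3 * g) * (r * j) * t                          ≤⟨ ℕ.*-monoˡ-≤ t (ℕ.*-mono-≤ rate rj≤) ⟩
  d * suc (3 * g) * r * (5 + κ + r) * t                ≡⟨ e₂ d (3 * g) r κ t ⟩
  d * t * r * (suc (3 * g) * (4 + r) + suc (3 * g) * (1 + κ)) ≤⟨ ℕ.*-monoʳ-≤ (d * t * r) (ℕ.+-monoˡ-≤ _ κ-large) ⟩
  d * t * r * (κ + suc (3 * g) * (1 + κ))              <⟨ ℕ.*-monoʳ-< (d * t * r) {{ℕ.m*n≢0 (d * t) r {{ℕ.m*n≢0 d t}}}} (ℕ.+-monoˡ-< _ (ℕ.m<m+n κ {2 + κ} (s≤s z≤n))) ⟩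
  d * t * r * (κ + (2 + κ) + suc (3 * g) * (1 + κ)) ≡⟨ e₃ d t r κ g ⟩
  3 * r * (d * t * (1 + κ) * (1 + g))                  ∎)
  where
  open ℕ.≤-Reasoning
  S = scc (K t d)
  k = 5 + κ
  -- Rounded up so that r * j > k, which gives t < 2 ^ suc k ≤ 2 ^ (r * j); the rounding adds at
  -- most r.
  j = suc (k ℕ./ r)
  t≤ : t ≤ 2 ^ (r * j)
  t≤ = ℕ.≤-trans (ℕ.<⇒≤ t<) (ℕ.^-monoʳ-≤ 2 (begin-strict
    k                             ≡⟨ m≡m%n+[m/n]*n k r ⟩
    k % r + k ℕ./ r * r     <⟨ ℕ.+-monoˡ-< (k ℕ./ r * r) (m%n<n k r) ⟩
    j * r                       ≡⟨ ℕ.*-comm j r ⟩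
    r * j                       ∎))
  rj≤ : r * j ≤ k + r
  rj≤ = begin
    r * j                       ≡⟨ ℕ.*-comm r j ⟩
    r + k ℕ./ r * r           ≤⟨ ℕ.+-monoʳ-≤ r (m/n*n≤m k r) ⟩
    r + k                       ≡⟨ ℕ.+-comm r k ⟩
    k + r                       ∎
  e₁ : ∀ r j n t g → 3 * r * (2 * (j * n * t) * g) ≡ 2 * n * (3 * g) * (r * j) * t
  e₁ = solve-∀
  e₂ : ∀ d q r κ t → d * suc q * r * (5 + κ + r) * t ≡ d * t * r * (suc q * (4 + r) + suc q * (1 + κ))
  e₂ = solve-∀
  e₃ : ∀ d t r κ g → d * t * r * (κ + (2 + κ) + suc (3 * g) * (1 + κ)) ≡ 3 * r * (d * t * (1 + κ) * (1 + g))
  e₃ = solve-∀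

corollary8 : (d : ℕ) (2≤d : 2 ≤ d) →
    Tendsto 2 (λ t 2≤t → (+ scc (K t d) / 1) ÷ ½d·t·log₂ d t 2≤t [ ½d·t·log₂-pos d t 2≤d 2≤t ]) 1ℚᵘ
corollary8 d 2≤d (mkℚᵘ -[1+ _ ] f) (*<* ())
corollary8 d 2≤d (mkℚᵘ (+ zero) f) (*<* (ℤ.+<+ ()))
-- As ε = suc e / suc f is at least 1 / suc f, a rate within a third of 1 / suc f is enough, as in
-- `scc-numeric`.
corollary8 d@(suc d-1) 2≤d (mkℚᵘ (+ suc e) f) _ = from-code (good-code d 2≤d (3 * suc f) (s≤s z≤n))
  where
  from-code : _ → _
  from-code (n , r , 1≤r , rate , c , sep) = 2 ^ K₀ , λ { t@(suc t-1) 2≤t T≤t → bounds t-1 2≤t T≤t (floor-log₂ t (s≤s z≤n)) }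
    where
    -- The first summand is what `scc-numeric` needs for the upper bound, the second what
    -- `lower-bound` needs.
    κ₀ = suc (3 * suc f) * (4 + r) + 5 * suc f
    K₀ = 5 + κ₀
    bounds : ∀ t-1 (2≤t : 2 ≤ suc t-1) → 2 ^ K₀ ≤ suc t-1 → (∃ λ k → 2 ^ k ≤ suc t-1 × suc t-1 < 2 ^ suc k) →
      ℝ.Lower (Limit.quot d-1 t-1 2≤d 2≤t) (1ℚᵘ ℚᵘ.- frac (suc e) f) × ℝ.Upper (Limit.quot d-1 t-1 2≤d 2≤t) (1ℚᵘ ℚᵘ.+ frac (suc e) f)
    bounds t-1 2≤t T≤t (k , 2^k≤t , t<) =
      lower-bound e f k t< (scc-lower t d 2≤d k 2^k≤t) (ℕ.≤-trans (ℕ.m≤n+m (5 * suc f) (suc (3 * suc f) * (4 + r))) (ℕ.≤-trans (ℕ.m≤n+m κ₀ 5) K₀≤k)) ,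
      upper-bound e f κ (ℕ.≤-trans (ℕ.≤-reflexive (cong (2 ^_) (sym k≡))) 2^k≤t) (scc-numeric {n = n} {r} {suc f} t κ {{_}} {{_}} {{>-nonZero 1≤r}} rate c sep (subst (λ k → t < 2 ^ suc k) k≡ t<) κ-large)
      where
      open Limit d-1 t-1 2≤d 2≤t using (t; lower-bound; upper-bound)
      K₀≤k : K₀ ≤ k
      K₀≤k = 2^-cancel-≤ (ℕ.≤-<-trans T≤t t<)
      κ = k ∸ 5
      k≡ : k ≡ 5 + κ
      k≡ = sym (ℕ.m+[n∸m]≡n (ℕ.≤-trans (ℕ.m≤m+n 5 κ₀) K₀≤k))
      κ-large : suc (3 * suc f) * (4 + r) ≤ κ
      κ-large = ℕ.≤-trans (ℕ.m≤m+n _ (5 * suc f)) (ℕ.+-cancelˡ-≤ 5 _ _ (ℕ.≤-trans K₀≤k (ℕ.≤-reflexive k≡)))
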